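{- Let $G=(V,E)$ be an oriented graph and $V'\subseteq V$ with $|V'|=3$. Let $T$ be the number of $E'\subseteq E$ such that $(V',E')$ is a triangle (the three arcs of a $3$-cycle on $V'$), and let $F$ be the number of $E'\subseteq E$ with $|E'|=3$ such that $(V',E')$ is a rootless forest. Then, with $\omega_2=-1$ and $\omega_4=i$, $$\det L_{\omega_2}[V']-\det L_{\omega_4}[V']=2T,\qquad 2\det L_{\omega_4}[V']-\det L_{\omega_2}[V']=F.$$
   Context: An oriented graph is a finite directed graph with no loops, no multiple arcs, and no pair of opposite arcs. For $|\omega|=1$, $L_\omega(G)$ is the $V\times V$ matrix with diagonal entry at $u$ the number of arcs incident with $u$ and $(u,v)$ entry ($u\ne v$) $-\omega$ if $u\to v$, $-\overline\omega$ if $v\to u$, $0$ otherwise; $L_\omega[V']$ is its principal submatrix on $V'$. A substructure is $(V',E')$ with $V'\subseteq V$, $E'\subseteq E$ (arcs may leave $V'$). Its connected components are the classes $V'_i$ of vertices of $V'$ joined by paths (ignoring directions) with vertices in $V'$ and arcs in $E'$, together with the arcs $E'_i$ of $E'$ having an endpoint in $V'_i$. A rootless tree is a substructure $(V',E')$, $V'\ne\emptyset$, obtained from a tree graph $(V'\cup\{w\},E')$ (all arcs with both ends in $V'\cup\{w\}$, underlying undirected graph a tree) in which $w\notin V'$ is a leaf, by deleting $w$ but keeping its arc. A rootless forest is a substructure each of whose connected components is a rootless tree and in which every arc has an endpoint in $V'$. -}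

module Defs where

open import Algebra.Bundles.Raw using (RawRing)
open import Algebra.Definitions.RawMonoid using (sum)
open import Data.Bool.Base using (if_then_else_)
import Data.Bool.Properties as Bool
open import Data.Fin.Base using (Fin; zero; suc; toℕ; punchIn)
import Data.Fin.Properties as Fin
open import Data.Fin.Subset using (Subset; inside; outside; _∈_; _∉_; _∪_; _∩_; ⁅_⁆; ∣_∣; Nonempty)
open import Data.Fin.Subset.Properties using (_∈?_; nonempty?)
open import Data.Integer.Base as ℤ using (ℤ; 0ℤ; 1ℤ; -1ℤ; +_)
open import Data.List.Base as List using (List; []; _∷_; _++_; length; head; last; filter; allFin; cartesianProductWith)
import Data.List.Membership.Propositional as List
open import Data.List.Membership.Propositional.Properties using (∈-cartesianProductWith⁺; ∈-allFin; ∈-lookup)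
open import Data.List.Relation.Unary.All as All using (All)
open import Data.List.Relation.Unary.AllPairs.Core using (_∷_)
open import Data.List.Relation.Unary.Any as Any using (here; there)
open import Data.List.Relation.Unary.Linked using (Linked; linked?)
open import Data.List.Relation.Unary.Unique.Propositional using (Unique)
open import Data.List.Relation.Unary.Unique.DecPropositional using (unique?)
open import Data.Maybe.Base using (just)
import Data.Maybe.Properties as Maybe
open import Data.Nat.Base as ℕ using (ℕ; zero; suc; z≤n; s≤s)
import Data.Nat.Properties as ℕ
open import Data.Product.Base using (∃; ∃₂; _×_; _,_; proj₁; proj₂)
open import Data.Sum.Base using (_⊎_)
open import Data.Vec.Base as Vec using (Vec; []; _∷_)
import Data.Vec.Properties as Vec
open import Function.Base using (_∘_)
open import Level using (0ℓ)
open import Relation.Binary.PropositionalEquality using (_≡_; _≢_; refl; sym; cong)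
open import Relation.Nullary using (¬_; Dec; does; yes; no; contradiction)
open import Relation.Nullary.Decidable using (map′; ¬?; _×-dec_; _⊎-dec_; _→-dec_)
open import Relation.Unary using (Pred; Decidable)

infix 5 _+i_

record ℤ[i] : Set where
  constructor _+i_
  field
    re im : ℤ

open ℤ[i] public

infix  8 ⊖_
infixl 7 _⊗_
infixl 6 _⊕_ _⊝_

_⊕_ _⊗_ _⊝_ : ℤ[i] → ℤ[i] → ℤ[i]
(a +i b) ⊕ (c +i d) = (a ℤ.+ c) +i (b ℤ.+ d)
(a +i b) ⊗ (c +i d) = (a ℤ.* c ℤ.- b ℤ.* d) +i (a ℤ.* d ℤ.+ b ℤ.* c)

⊖_ conj : ℤ[i] → ℤ[i]
⊖ (a +i b) = (ℤ.- a) +i (ℤ.- b)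
conj (a +i b) = a +i (ℤ.- b)

x ⊝ y = x ⊕ (⊖ y)

fromℕ : ℕ → ℤ[i]
fromℕ k = (+ k) +i 0ℤ

ω₂ ω₄ : ℤ[i]
ω₂ = -1ℤ +i 0ℤ
ω₄ = 0ℤ +i 1ℤ

ℤ[i]-rawRing : RawRing 0ℓ 0ℓ
ℤ[i]-rawRing = record
  { Carrier = ℤ[i]
  ; _≈_     = _≡_
  ; _+_     = _⊕_
  ; _*_     = _⊗_
  ; -_      = ⊖_
  ; 0#      = fromℕ 0
  ; 1#      = fromℕ 1
  }

Matrix : ℕ → Set
Matrix k = Fin k → Fin k → ℤ[i]

sign : ℕ → ℤ[i] → ℤ[i]
sign zero    x = x
sign (suc k) x = ⊖ sign k x

-- Laplace expansion along the first row.
det : ∀ {k} → Matrix k → ℤ[i]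
det {zero}  M = fromℕ 1
det {suc k} M = sum (RawRing.+-rawMonoid ℤ[i]-rawRing)
  (λ j → sign (toℕ j) (M zero j ⊗ det (λ r c → M (suc r) (punchIn j c))))

elements : ∀ {n} (S : Subset n) → Vec (Fin n) ∣ S ∣
elements []            = []
elements (inside  ∷ S) = zero ∷ Vec.map suc (elements S)
elements (outside ∷ S) = Vec.map suc (elements S)

-- Rows and columns are taken in increasing order of the elements of S.
principal : ∀ {n} → Matrix n → (S : Subset n) → Matrix ∣ S ∣
principal M S r c = M (Vec.lookup (elements S) r) (Vec.lookup (elements S) c)

subsetOf : ∀ {n} {P : Pred (Fin n) 0ℓ} → Decidable P → Subset n
subsetOf P? = Vec.tabulate (does ∘ P?)

allSubsets : ∀ n → List (Subset n)
allSubsets zero    = [] ∷ []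
allSubsets (suc n) = List.map (outside ∷_) (allSubsets n) ++ List.map (inside ∷_) (allSubsets n)

numberOfSubsets : ∀ {n} {P : Pred (Subset n) 0ℓ} → Decidable P → ℕ
numberOfSubsets {n} P? = length (filter P? (allSubsets n))

_≟ˢ_ : ∀ {n} (S S′ : Subset n) → Dec (S ≡ S′)
_≟ˢ_ = Vec.≡-dec Bool._≟_

module _ {n : ℕ} where

  lookup-injective : ∀ {xs : List (Fin n)} → Unique xs → ∀ {i j} →
                     List.lookup xs i ≡ List.lookup xs j → i ≡ j
  lookup-injective (_ ∷ _)   {zero}  {zero}  _  = refl
  lookup-injective (x∉ ∷ _)  {zero}  {suc j} eq = contradiction eq (All.lookup x∉ (∈-lookup j))
  lookup-injective (x∉ ∷ _)  {suc i} {zero}  eq = contradiction (sym eq) (All.lookup x∉ (∈-lookup i))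
  lookup-injective (_ ∷ xs!) {suc i} {suc j} eq = cong suc (lookup-injective xs! eq)

  length-unique : ∀ {xs : List (Fin n)} → Unique xs → length xs ℕ.≤ n
  length-unique xs! = Fin.injective⇒≤ (lookup-injective xs!)

  listsUpTo : ℕ → List (List (Fin n))
  listsUpTo zero    = [] ∷ []
  listsUpTo (suc k) = [] ∷ cartesianProductWith _∷_ (allFin n) (listsUpTo k)

  ∈-listsUpTo : ∀ {k} (xs : List (Fin n)) → length xs ℕ.≤ k → xs List.∈ listsUpTo k
  ∈-listsUpTo {zero}  []       _       = here refl
  ∈-listsUpTo {suc k} []       _       = here refl
  ∈-listsUpTo {suc k} (x ∷ xs) (s≤s p) =
    there (∈-cartesianProductWith⁺ _∷_ (∈-allFin x) (∈-listsUpTo xs p))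

  anyUnique? : ∀ {P : Pred (List (Fin n)) 0ℓ} → (∀ {xs} → P xs → Unique xs) →
               Decidable P → Dec (∃ P)
  anyUnique? P⇒! P? = map′ Any.satisfied
    (λ (xs , p) → List.lose (∈-listsUpTo xs (length-unique (P⇒! p))) p)
    (Any.any? P? (listsUpTo n))

-- The vertex set is Fin n and the arc set Fin m.
record OrientedGraph (n m : ℕ) : Set where
  field
    source target : Fin m → Fin n
    noLoops       : ∀ e → source e ≢ target e
    noMultiple    : ∀ e f → source e ≡ source f → target e ≡ target f → e ≡ f
    noOpposite    : ∀ e f → source e ≡ target f → ¬ (target e ≡ source f)

-- No relation between the two fields: arcs may leave the vertex set.
record Substructure (n m : ℕ) : Set where
  constructor ⟨_,_⟩
  field
    vertices : Subset n
    arcs     : Subset m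

open Substructure public

module _ {n m : ℕ} (G : OrientedGraph n m) where

  open OrientedGraph G

  Arc : Fin n → Fin n → Set
  Arc u v = ∃ λ e → source e ≡ u × target e ≡ v

  arc? : ∀ u v → Dec (Arc u v)
  arc? u v = Fin.any? λ e → source e Fin.≟ u ×-dec target e Fin.≟ v

  Incident : Fin n → Fin m → Set
  Incident u e = source e ≡ u ⊎ target e ≡ u

  incident? : ∀ u e → Dec (Incident u e)
  incident? u e = source e Fin.≟ u ⊎-dec target e Fin.≟ u

  Joins : Fin m → Fin n → Fin n → Set
  Joins e u v = (source e ≡ u × target e ≡ v) ⊎ (source e ≡ v × target e ≡ u)

  joins? : ∀ e u v → Dec (Joins e u v)
  joins? e u v = (source e Fin.≟ u ×-dec target e Fin.≟ v)
           ⊎-dec (source e Fin.≟ v ×-dec target e Fin.≟ u)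

  incidentArcs : Fin n → Subset m
  incidentArcs u = subsetOf (incident? u)

  -- Meaningful for ω of modulus 1; only ω₂ and ω₄ are used.
  laplacian : ℤ[i] → Matrix n
  laplacian ω u v =
    if does (u Fin.≟ v)  then fromℕ ∣ incidentArcs u ∣
    else if does (arc? u v) then ⊖ ω
    else if does (arc? v u) then ⊖ conj ω
    else fromℕ 0

  Adjacent : Substructure n m → Fin n → Fin n → Set
  Adjacent H u v = ∃ λ e → e ∈ arcs H × Joins e u v

  adjacent? : ∀ H u v → Dec (Adjacent H u v)
  adjacent? H u v = Fin.any? λ e → e ∈? arcs H ×-dec joins? e u v

  IsPath : Substructure n m → Fin n → Fin n → List (Fin n) → Set
  IsPath H u v xs = Unique xs
                  × head xs ≡ just u
                  × last xs ≡ just v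
                  × All (_∈ vertices H) xs
                  × Linked (Adjacent H) xs

  isPath? : ∀ H u v → Decidable (IsPath H u v)
  isPath? H u v xs = unique? Fin._≟_ xs
               ×-dec Maybe.≡-dec Fin._≟_ (head xs) (just u)
               ×-dec Maybe.≡-dec Fin._≟_ (last xs) (just v)
               ×-dec All.all? (_∈? vertices H) xs
               ×-dec linked? (adjacent? H) xs

  Joined : Substructure n m → Fin n → Fin n → Set
  Joined H u v = ∃ (IsPath H u v)

  joined? : ∀ H u v → Dec (Joined H u v)
  joined? H u v = anyUnique? proj₁ (isPath? H u v)

  -- A path on at least three vertices whose ends are adjacent.
  IsCycle : Substructure n m → Fin n → Fin n → List (Fin n) → Set
  IsCycle H u v xs = IsPath H u v xs × 3 ℕ.≤ length xs × Adjacent H v u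

  HasCycle : Substructure n m → Set
  HasCycle H = ∃₂ λ u v → ∃ (IsCycle H u v)

  hasCycle? : Decidable HasCycle
  hasCycle? H = Fin.any? λ u → Fin.any? λ v → anyUnique? (proj₁ ∘ proj₁) λ xs →
    isPath? H u v xs ×-dec 3 ℕ.≤? length xs ×-dec adjacent? H v u

  HasEndIn : Subset n → Fin m → Set
  HasEndIn S e = source e ∈ S ⊎ target e ∈ S

  hasEndIn? : ∀ S → Decidable (HasEndIn S)
  hasEndIn? S e = source e ∈? S ⊎-dec target e ∈? S

  componentVertices : Substructure n m → Fin n → Subset n
  componentVertices H v = subsetOf (joined? H v)

  component : Substructure n m → Fin n → Substructure n m
  component H v = ⟨ C , arcs H ∩ subsetOf (hasEndIn? C) ⟩
    where C = componentVertices H v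

  IsGraph : Substructure n m → Set
  IsGraph H = ∀ e → e ∈ arcs H → source e ∈ vertices H × target e ∈ vertices H

  isGraph? : Decidable IsGraph
  isGraph? H = Fin.all? λ e → e ∈? arcs H →-dec source e ∈? vertices H ×-dec target e ∈? vertices H

  Connected : Substructure n m → Set
  Connected H = Nonempty (vertices H)
              × (∀ u → u ∈ vertices H → ∀ v → v ∈ vertices H → Joined H u v)

  connected? : Decidable Connected
  connected? H = nonempty? (vertices H)
           ×-dec (Fin.all? λ u → u ∈? vertices H →-dec
                  Fin.all? λ v → v ∈? vertices H →-dec joined? H u v)

  IsTree : Substructure n m → Set
  IsTree H = IsGraph H × Connected H × ¬ HasCycle H

  isTree? : Decidable IsTree
  isTree? H = isGraph? H ×-dec connected? H ×-dec ¬? (hasCycle? H)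

  IsLeaf : Substructure n m → Fin n → Set
  IsLeaf H w = w ∈ vertices H × ∣ arcs H ∩ incidentArcs w ∣ ≡ 1

  isLeaf? : ∀ H → Decidable (IsLeaf H)
  isLeaf? H w = w ∈? vertices H ×-dec ∣ arcs H ∩ incidentArcs w ∣ ℕ.≟ 1

  addVertex : Substructure n m → Fin n → Substructure n m
  addVertex H w = ⟨ vertices H ∪ ⁅ w ⁆ , arcs H ⟩

  IsRootlessTree : Substructure n m → Set
  IsRootlessTree H = Nonempty (vertices H)
                   × ∃ λ w → w ∉ vertices H × IsTree (addVertex H w) × IsLeaf (addVertex H w) w

  isRootlessTree? : Decidable IsRootlessTree
  isRootlessTree? H = nonempty? (vertices H)
    ×-dec Fin.any? λ w → ¬? (w ∈? vertices H) ×-dec isTree? (addVertex H w) ×-dec isLeaf? (addVertex H w) w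

  IsRootlessForest : Substructure n m → Set
  IsRootlessForest H = (∀ v → v ∈ vertices H → IsRootlessTree (component H v))
                     × (∀ e → e ∈ arcs H → HasEndIn (vertices H) e)

  isRootlessForest? : Decidable IsRootlessForest
  isRootlessForest? H =
          (Fin.all? λ v → v ∈? vertices H →-dec isRootlessTree? (component H v))
    ×-dec (Fin.all? λ e → e ∈? arcs H →-dec hasEndIn? (vertices H) e)

  -- The 3-cycle is one of the underlying undirected graph: its arcs may be
  -- oriented cyclically or transitively.
  IsTriangle : Substructure n m → Set
  IsTriangle H =
    ∃ λ a → ∃ λ b → ∃ λ c → ∃ λ e → ∃ λ f → ∃ λ g →
      (a ≢ b × b ≢ c × c ≢ a)
    × vertices H ≡ ⁅ a ⁆ ∪ ⁅ b ⁆ ∪ ⁅ c ⁆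
    × (Joins e a b × Joins f b c × Joins g c a)
    × arcs H ≡ ⁅ e ⁆ ∪ ⁅ f ⁆ ∪ ⁅ g ⁆

  isTriangle? : Decidable IsTriangle
  isTriangle? H =
    Fin.any? λ a → Fin.any? λ b → Fin.any? λ c → Fin.any? λ e → Fin.any? λ f → Fin.any? λ g →
          (¬? (a Fin.≟ b) ×-dec ¬? (b Fin.≟ c) ×-dec ¬? (c Fin.≟ a))
    ×-dec vertices H ≟ˢ (⁅ a ⁆ ∪ ⁅ b ⁆ ∪ ⁅ c ⁆)
    ×-dec (joins? e a b ×-dec joins? f b c ×-dec joins? g c a)
    ×-dec arcs H ≟ˢ (⁅ e ⁆ ∪ ⁅ f ⁆ ∪ ⁅ g ⁆)

  numberOfTriangles : Subset n → ℕ
  numberOfTriangles V′ = numberOfSubsets {m} λ E′ → isTriangle? ⟨ V′ , E′ ⟩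

  numberOfRootlessForests : Subset n → ℕ → ℕ
  numberOfRootlessForests V′ k =
    numberOfSubsets {m} λ E′ → ∣ E′ ∣ ℕ.≟ k ×-dec isRootlessForest? ⟨ V′ , E′ ⟩

module Submission where

-- Contract the vertices outside V′ to a single vertex 0, which turns V′ into the other three
-- vertices of K₄ and sorts the arcs meeting V′ into the six edges of K₄. A rootless forest
-- (V′ , E′) with three arcs is exactly an E′ consisting of one arc from each of the three
-- edges of a spanning tree of K₄, and a triangle is one arc from each edge avoiding 0. Hence
-- F and T are polynomials in the sizes of the six arc classes, and so are the determinants:
-- the degree of a vertex of V′ is the sum of three class sizes, the classes inside V′ have
-- size 0 or 1, and the two cyclic terms of the expansion give 2T for ω₂ and cancel for ω₄,
-- where they are opposite and purely imaginary.

open import Defs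
open import Data.Bool.Base using (Bool; true; false; if_then_else_)
open import Data.Fin using (#_)
open import Data.Fin.Base using (Fin; zero; suc; punchIn; punchOut)
import Data.Fin.Properties as Fin
open import Data.Fin.Subset using (Subset; inside; outside; _∈_; _∉_; _∪_; _∩_; _-_; ⁅_⁆; ∣_∣; ⊥; Nonempty)
open import Data.Fin.Subset.Properties using (_∈?_; ∉⊥; Empty-unique; p─⊥≡p; p─q⊆p; x∈p∧x≢y⇒x∈p-y; x∈⁅x⁆; x∈⁅y⁆⇒x≡y; ∣⁅x⁆∣≡1; ⊆-antisym; ∣⊥∣≡0; anySubset?; x∈p∪q⁻; x∈p∪q⁺; x∈p∩q⁻; x∈p∩q⁺)
open import Data.Integer.Base as ℤ using (ℤ; 0ℤ; 1ℤ; -1ℤ; +_)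
import Data.Integer.Properties as ℤ
import Data.Integer.Solver as ℤ-Solver
open import Data.List.Base as List using (List; []; _∷_; length; filter; last; allFin; cartesianProductWith)
open import Data.List.Membership.DecPropositional using () renaming (_∈?_ to _∈ˡ?_)
import Data.List.Membership.Propositional as List
open import Data.List.Membership.Propositional using (find; lose)
open import Data.List.Membership.Propositional.Properties using (∈-map⁻; ∈-filter⁻)
import Data.List.Properties as List
open import Data.List.Relation.Unary.All as All using (All; []; _∷_)
open import Data.List.Relation.Unary.All.Properties using (All¬⇒¬Any; ¬Any⇒All¬)
open import Data.List.Relation.Unary.AllPairs.Core using ([]; _∷_)
open import Data.List.Relation.Unary.Any as Any using (Any; here; there)
open import Data.List.Relation.Unary.Linked using (Linked; [-]; _∷_)
open import Data.List.Relation.Unary.Unique.DecPropositional using (unique?)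
open import Data.List.Relation.Unary.Unique.Propositional using (Unique)
open import Data.Maybe.Base using (just)
open import Data.Nat.Base as ℕ using (ℕ; zero; suc; _+_; _*_; _≤_; _<_; z≤n; s≤s)
open import Data.Nat.Induction using (<-wellFounded)
import Data.Nat.ListAction as ListAction
import Data.Nat.Properties as ℕ
import Data.Nat.Tactic.RingSolver as ℕ-Solver
open import Data.Product.Base using (∃; ∃₂; _×_; _,_; proj₁; proj₂)
open import Data.Sum.Base as Sum using (_⊎_; inj₁; inj₂; [_,_]′)
open import Data.Vec.Base as Vec using (Vec; []; _∷_; here; there; lookup)
import Data.Vec.Properties as Vec
open import Function.Base using (_∘_; id)
open import Function.Bundles using (mk⇔)
open import Induction.WellFounded using (Acc; acc)
open import Level using (0ℓ)
open import Relation.Binary.Construct.Closure.ReflexiveTransitive using (Star; ε; _◅_; _◅◅_; reverse)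
open import Relation.Binary.PropositionalEquality using (_≡_; _≢_; refl; sym; trans; cong; cong₂; subst; module ≡-Reasoning)
open import Relation.Nullary using (¬_; Dec; does; yes; no; contradiction)
open import Relation.Nullary.Decidable using (map′; ¬?; _×-dec_; _⊎-dec_; _→-dec_; from-yes; from-no; decidable-stable; dec-true; dec-false; does-⇔)
open import Relation.Unary using (Pred; Decidable; _≐_)

-- Two arcs leaving one component towards different outer vertices close no cycle in `G`, yet the
-- component is no rootless tree: its outer arcs must all meet the one deleted leaf, and that leaf
-- carries a single arc. Contraction turns this defect into a cycle through 0, while two components
-- hanging on a common outer vertex remain legitimate. From a forest only this is extracted: a
-- component has an arc leaving `V′`, and no second one. With three arcs this suffices, since the
-- only 3-sets of edges of K₄ that are not trees are its four triangles. Conversely, the orientation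
-- of a tree towards 0 gives a parent map, from which connectedness, acyclicity and the deleted leaf
-- are derived. The combination in the second identity comes from the ordinary Laplacian. As ω has
-- modulus 1, it enters only through the cyclic terms: they are -2T for ω = 1, 2T for ω = -1 and 0
-- for ω = i, so twice the last minus the second reproduces the first. The result is a reduced
-- Laplacian determinant of K₄ weighted by the class sizes, which Kirchhoff's theorem expands over
-- spanning trees.

private
  variable
    k m n : ℕ

-- Membership and cardinality of subsets.

∈-subsetOf⁺ : {P : Pred (Fin n) 0ℓ} (P? : Decidable P) → ∀ {v} → P v → v ∈ subsetOf P?
∈-subsetOf⁺ P? {v} p =
  Vec.lookup⇒[]= v _ (trans (Vec.lookup∘tabulate (does ∘ P?) v) (dec-true (P? v) p))

∈-subsetOf⁻ : {P : Pred (Fin n) 0ℓ} (P? : Decidable P) → ∀ {v} → v ∈ subsetOf P? → P v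
∈-subsetOf⁻ P? {v} v∈
  with P? v | trans (sym (Vec.lookup∘tabulate (does ∘ P?) v)) (Vec.[]=⇒lookup v∈)
... | yes p | _ = p
... | no  _ | ()

∣p∣≡1⁺ : {p : Subset n} {x : Fin n} → x ∈ p → (∀ {y} → y ∈ p → y ≡ x) → ∣ p ∣ ≡ 1
∣p∣≡1⁺ {p = p} {x} x∈p only-x = trans (cong ∣_∣ p≡⁅x⁆) (∣⁅x⁆∣≡1 x)
  where
  p≡⁅x⁆ : p ≡ ⁅ x ⁆
  p≡⁅x⁆ = ⊆-antisym (λ y∈p → subst (_∈ ⁅ x ⁆) (sym (only-x y∈p)) (x∈⁅x⁆ x))
                    (λ y∈ → subst (_∈ p) (sym (x∈⁅y⁆⇒x≡y x y∈)) x∈p)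

∣p∣≡0⁻ : {p : Subset n} → ∣ p ∣ ≡ 0 → ∀ {x} → x ∉ p
∣p∣≡0⁻ {p = outside ∷ p} eq (there x∈p) = ∣p∣≡0⁻ eq x∈p

∣p∣≡0⁺ : {p : Subset n} → (∀ {x} → x ∉ p) → ∣ p ∣ ≡ 0
∣p∣≡0⁺ {n} ∉p = trans (cong ∣_∣ (Empty-unique (λ (_ , x∈p) → ∉p x∈p))) (∣⊥∣≡0 n)

∣p∣≡1⇒nonempty : {p : Subset n} → ∣ p ∣ ≡ 1 → Nonempty p
∣p∣≡1⇒nonempty {p = inside  ∷ p} _  = zero , here
∣p∣≡1⇒nonempty {p = outside ∷ p} eq = let x , x∈p = ∣p∣≡1⇒nonempty eq in suc x , there x∈p

∣p∣≡1⇒unique : {p : Subset n} → ∣ p ∣ ≡ 1 → ∀ {x y} → x ∈ p → y ∈ p → x ≡ y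
∣p∣≡1⇒unique {p = inside  ∷ p} eq here        here        = refl
∣p∣≡1⇒unique {p = inside  ∷ p} eq here        (there y∈p) = contradiction y∈p (∣p∣≡0⁻ (ℕ.suc-injective eq))
∣p∣≡1⇒unique {p = inside  ∷ p} eq (there x∈p) _           = contradiction x∈p (∣p∣≡0⁻ (ℕ.suc-injective eq))
∣p∣≡1⇒unique {p = outside ∷ p} eq (there x∈p) (there y∈p) = cong suc (∣p∣≡1⇒unique eq x∈p y∈p)

x∉p-x : (p : Subset n) (x : Fin n) → x ∉ p - x
x∉p-x (_ ∷ p) zero    ()
x∉p-x (_ ∷ p) (suc x) (there x∈) = x∉p-x p x x∈

x∈p⇒∣p∣≡1+∣p-x∣ : {p : Subset n} {x : Fin n} → x ∈ p → ∣ p ∣ ≡ suc ∣ p - x ∣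
x∈p⇒∣p∣≡1+∣p-x∣ {p = inside  ∷ p} here        = cong (suc ∘ ∣_∣) (sym (p─⊥≡p p))
x∈p⇒∣p∣≡1+∣p-x∣ {p = inside  ∷ p} (there x∈p) = cong suc (x∈p⇒∣p∣≡1+∣p-x∣ x∈p)
x∈p⇒∣p∣≡1+∣p-x∣ {p = outside ∷ p} (there x∈p) = x∈p⇒∣p∣≡1+∣p-x∣ x∈p

-- Counting the subsets that satisfy a predicate.

indicator : Bool → ℕ
indicator b = if b then 1 else 0

∣b∷p∣ : ∀ b (p : Subset n) → ∣ b ∷ p ∣ ≡ indicator b + ∣ p ∣
∣b∷p∣ inside  p = refl
∣b∷p∣ outside p = refl

numberOfSubsets-cong : {P Q : Pred (Subset m) 0ℓ} (P? : Decidable P) (Q? : Decidable Q) →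
                       P ≐ Q → numberOfSubsets P? ≡ numberOfSubsets Q?
numberOfSubsets-cong {m} P? Q? P≐Q = cong length (List.filter-≐ P? Q? P≐Q (allSubsets m))

length-filter-map : {A B : Set} {P : Pred B 0ℓ} (P? : Decidable P) (f : A → B) → ∀ xs →
                    length (filter P? (List.map f xs)) ≡ length (filter (P? ∘ f) xs)
length-filter-map P? f []       = refl
length-filter-map P? f (x ∷ xs) with does (P? (f x))
... | true  = cong suc (length-filter-map P? f xs)
... | false = length-filter-map P? f xs

numberOfSubsets-suc : {P : Pred (Subset (suc m)) 0ℓ} (P? : Decidable P) →
  numberOfSubsets P? ≡ numberOfSubsets (P? ∘ (outside ∷_)) + numberOfSubsets (P? ∘ (inside ∷_))
numberOfSubsets-suc {m} P? =
  trans (cong length (List.filter-++ P? (List.map (outside ∷_) (allSubsets m)) _))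
 (trans (List.length-++ (filter P? (List.map (outside ∷_) (allSubsets m))))
        (cong₂ _+_ (length-filter-map P? (outside ∷_) (allSubsets m))
                   (length-filter-map P? (inside ∷_) (allSubsets m))))

numberOfSubsets-none : {P : Pred (Subset m) 0ℓ} (P? : Decidable P) →
                       (∀ S → ¬ P S) → numberOfSubsets P? ≡ 0
numberOfSubsets-none {m} P? ¬P = cong length (List.filter-none P? (All.universal ¬P (allSubsets m)))

length-filter-⊎ : {A : Set} {P Q R : Pred A 0ℓ}
  (P? : Decidable P) (Q? : Decidable Q) (R? : Decidable R) →
  (∀ {x} → P x → Q x ⊎ R x) → (∀ {x} → Q x → P x) → (∀ {x} → R x → P x) →
  (∀ {x} → Q x → ¬ R x) → ∀ xs →
  length (filter P? xs) ≡ length (filter Q? xs) + length (filter R? xs)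
length-filter-⊎ P? Q? R? split Q⇒P R⇒P Q⇒¬R [] = refl
length-filter-⊎ P? Q? R? split Q⇒P R⇒P Q⇒¬R (x ∷ xs)
  with P? x | Q? x | R? x | length-filter-⊎ P? Q? R? split Q⇒P R⇒P Q⇒¬R xs
... | yes _ | yes q | yes r | _  = contradiction r (Q⇒¬R q)
... | yes _ | yes _ | no  _ | ih = cong suc ih
... | yes _ | no  _ | yes _ | ih = trans (cong suc ih) (sym (ℕ.+-suc _ _))
... | yes p | no ¬q | no ¬r | _  = contradiction (split p) [ ¬q , ¬r ]′
... | no ¬p | yes q | _     | _  = contradiction (Q⇒P q) ¬p
... | no ¬p | no  _ | yes r | _  = contradiction (R⇒P r) ¬p
... | no  _ | no  _ | no  _ | ih = ih

-- A subset satisfies `R i` for at most one `i`, so the sum counts it once; a repeated index would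
-- spoil this, whence `Unique`.
numberOfSubsets-Any : {I : Set} {R : I → Pred (Subset m) 0ℓ} (R? : ∀ i → Decidable (R i)) →
  (∀ {i j S} → R i S → R j S → i ≡ j) → ∀ {is} → Unique is →
  numberOfSubsets (λ S → Any.any? (λ i → R? i S) is) ≡ ListAction.sum (List.map (numberOfSubsets ∘ R?) is)
numberOfSubsets-Any R? disjoint [] = numberOfSubsets-none (λ S → Any.any? (λ i → R? i S) []) (λ S ())
numberOfSubsets-Any {m} {R = R} R? disjoint {i ∷ is} (i∉is ∷ is!) =
  trans (length-filter-⊎ (λ S → Any.any? (λ i → R? i S) (i ∷ is)) (R? i) (λ S → Any.any? (λ i → R? i S) is)
          (λ { (here r) → inj₁ r ; (there rs) → inj₂ rs }) here there
          (λ r rs → All¬⇒¬Any (All.map (λ i≢j r′ → i≢j (disjoint r r′)) i∉is) rs) (allSubsets m))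
        (cong (numberOfSubsets (R? i) ℕ.+_) (numberOfSubsets-Any R? disjoint is!))

-- Transversals of a family of classes and their number.

record Transversal {k m} (τ : Fin m → Fin k) (K : Subset k) (S : Subset m) : Set where
  constructor transversal
  field
    injective  : ∀ e → e ∈ S → ∀ f → f ∈ S → τ e ≡ τ f → e ≡ f
    into       : ∀ e → e ∈ S → τ e ∈ K
    surjective : ∀ t → t ∈ K → ∃ λ e → e ∈ S × τ e ≡ t

open Transversal

transversal? : ∀ (τ : Fin m → Fin k) K → Decidable (Transversal τ K)
transversal? τ K S = map′ (λ (i , j , s) → transversal i j s) (λ (transversal i j s) → i , j , s)
  (     (Fin.all? λ e → e ∈? S →-dec Fin.all? λ f → f ∈? S →-dec τ e Fin.≟ τ f →-dec e Fin.≟ f)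
  ×-dec (Fin.all? λ e → e ∈? S →-dec τ e ∈? K)
  ×-dec (Fin.all? λ t → t ∈? K →-dec Fin.any? λ e → e ∈? S ×-dec τ e Fin.≟ t))

-- `K` is the image of `S` under `τ`. Hence different trees have disjoint families of transversals,
-- and their numbers can be added.
transversal-unique : ∀ {τ : Fin m → Fin k} {K L S} → Transversal τ K S → Transversal τ L S → K ≡ L
transversal-unique {τ = τ} tr tr′ = ⊆-antisym (incl tr tr′) (incl tr′ tr)
  where
  incl : ∀ {K L S} → Transversal τ K S → Transversal τ L S → ∀ {t} → t ∈ K → t ∈ L
  incl tr tr′ {t} t∈K = let e , e∈S , τe≡t = surjective tr t t∈K in
    subst (_∈ _) τe≡t (into tr′ e e∈S)

module _ {τ : Fin (suc m) → Fin k} {K : Subset k} {S : Subset m} where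

  transversal-outside⁺ : Transversal (τ ∘ suc) K S → Transversal τ K (outside ∷ S)
  transversal-outside⁺ tr .injective  _ (there e∈) _ (there f∈) eq = cong suc (injective tr _ e∈ _ f∈ eq)
  transversal-outside⁺ tr .into       _ (there e∈)                 = into tr _ e∈
  transversal-outside⁺ tr .surjective t t∈K =
    let e , e∈S , eq = surjective tr t t∈K in suc e , there e∈S , eq

  transversal-outside⁻ : Transversal τ K (outside ∷ S) → Transversal (τ ∘ suc) K S
  transversal-outside⁻ tr .injective  _ e∈ _ f∈ eq = Fin.suc-injective (injective tr _ (there e∈) _ (there f∈) eq)
  transversal-outside⁻ tr .into       _ e∈         = into tr _ (there e∈)
  transversal-outside⁻ tr .surjective t t∈K with surjective tr t t∈K
  ... | _ , there e∈S , eq = _ , e∈S , eq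

  -- Choosing `zero` uses up its class: the rest of `S` may not meet `τ zero` again, hence
  -- `K - τ zero`.
  transversal-inside⁺ : τ zero ∈ K → Transversal (τ ∘ suc) (K - τ zero) S → Transversal τ K (inside ∷ S)
  transversal-inside⁺ t∈K tr .injective _ here _ here _ = refl
  transversal-inside⁺ t∈K tr .injective _ here _ (there f∈) eq =
    contradiction (into tr _ f∈) (subst (λ t → t ∉ K - τ zero) eq (x∉p-x K (τ zero)))
  transversal-inside⁺ t∈K tr .injective _ (there e∈) _ here eq =
    contradiction (into tr _ e∈) (subst (λ t → t ∉ K - τ zero) (sym eq) (x∉p-x K (τ zero)))
  transversal-inside⁺ t∈K tr .injective _ (there e∈) _ (there f∈) eq = cong suc (injective tr _ e∈ _ f∈ eq)
  transversal-inside⁺ t∈K tr .into _ here       = t∈K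
  transversal-inside⁺ t∈K tr .into _ (there e∈) = p─q⊆p K ⁅ τ zero ⁆ (into tr _ e∈)
  transversal-inside⁺ t∈K tr .surjective t t∈ with t Fin.≟ τ zero
  ... | yes t≡ = zero , here , sym t≡
  ... | no  t≢ = let e , e∈S , eq = surjective tr t (x∈p∧x≢y⇒x∈p-y t∈ t≢) in suc e , there e∈S , eq

  transversal-inside⁻ : Transversal τ K (inside ∷ S) → Transversal (τ ∘ suc) (K - τ zero) S
  transversal-inside⁻ tr .injective  _ e∈ _ f∈ eq = Fin.suc-injective (injective tr _ (there e∈) _ (there f∈) eq)
  transversal-inside⁻ tr .into       _ e∈ = x∈p∧x≢y⇒x∈p-y (into tr _ (there e∈))
    λ eq → contradiction (injective tr _ (there e∈) _ here eq) λ ()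
  transversal-inside⁻ tr .surjective t t∈ with surjective tr t (p─q⊆p K ⁅ τ zero ⁆ t∈)
  ... | _ , here      , eq = contradiction t∈ (subst (λ t → t ∉ K - τ zero) eq (x∉p-x K (τ zero)))
  ... | _ , there e∈S , eq = _ , e∈S , eq

transversal-∣∣ : ∀ {τ : Fin m → Fin k} {K S} → Transversal τ K S → ∣ S ∣ ≡ ∣ K ∣
transversal-∣∣ {S = []} tr =
  sym (∣p∣≡0⁺ λ t∈K → contradiction (proj₁ (surjective tr _ t∈K)) λ ())
transversal-∣∣ {S = outside ∷ S} tr = transversal-∣∣ (transversal-outside⁻ tr)
transversal-∣∣ {S = inside  ∷ S} tr =
  trans (cong suc (transversal-∣∣ (transversal-inside⁻ tr))) (sym (x∈p⇒∣p∣≡1+∣p-x∣ (into tr _ here)))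

-- The monomial of `K` in the variables `f`. For a concrete `K` it unfolds to a product ending in a
-- factor 1, the shape in which `spanning-tree-identity` is written.
weight : Subset k → (Fin k → ℕ) → ℕ
weight []            f = 1
weight (inside  ∷ K) f = f zero * weight K (f ∘ suc)
weight (outside ∷ K) f = weight K (f ∘ suc)

weight-cong : ∀ (K : Subset k) {f g} → (∀ t → t ∈ K → f t ≡ g t) → weight K f ≡ weight K g
weight-cong []            f≗g = refl
weight-cong (inside  ∷ K) f≗g = cong₂ _*_ (f≗g zero here) (weight-cong K λ t t∈ → f≗g (suc t) (there t∈))
weight-cong (outside ∷ K) f≗g = weight-cong K λ t t∈ → f≗g (suc t) (there t∈)

-- A monomial is linear in each of its variables, so raising one of them by 1 adds the monomial with
-- that factor removed.
weight-suc : ∀ (K : Subset k) {f g t} → t ∈ K → f t ≡ suc (g t) → (∀ s → s ≢ t → f s ≡ g s) →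
             weight K f ≡ weight K g + weight (K - t) g
weight-suc (inside ∷ K) {f} {g} here ft f≗g = trans
  (cong₂ _*_ ft (weight-cong K λ s _ → f≗g (suc s) λ ()))
  (trans (ℕ.+-comm (weight K (g ∘ suc)) _)
         (cong (λ L → g zero * weight K (g ∘ suc) + weight L (g ∘ suc)) (sym (p─⊥≡p K))))
weight-suc (inside ∷ K) {f} {g} (there t∈K) ft f≗g = trans
  (cong₂ _*_ (f≗g zero λ ()) (weight-suc K t∈K ft λ s s≢t → f≗g (suc s) (s≢t ∘ Fin.suc-injective)))
  (ℕ.*-distribˡ-+ (g zero) (weight K (g ∘ suc)) _)
weight-suc (outside ∷ K) (there t∈K) ft f≗g =
  weight-suc K t∈K ft λ s s≢t → f≗g (suc s) (s≢t ∘ Fin.suc-injective)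

weight-∅ : {f : Fin k → ℕ} → weight ⊥ f ≡ 1
weight-∅ {zero}  = refl
weight-∅ {suc k} = weight-∅ {k}

weight-zero : ∀ (K : Subset k) {f t} → t ∈ K → f t ≡ 0 → weight K f ≡ 0
weight-zero (inside  ∷ K) here        ft rewrite ft = refl
weight-zero (inside  ∷ K) {f} (there t∈K) ft rewrite weight-zero K {f ∘ suc} t∈K ft = ℕ.*-zeroʳ (f zero)
weight-zero (outside ∷ K) (there t∈K) ft = weight-zero K t∈K ft

classSize : (Fin m → Fin k) → Fin k → ℕ
classSize τ t = ∣ subsetOf (λ e → τ e Fin.≟ t) ∣

classSize-hit : ∀ (τ : Fin (suc m) → Fin k) → classSize τ (τ zero) ≡ suc (classSize (τ ∘ suc) (τ zero))
classSize-hit τ rewrite dec-true (τ zero Fin.≟ τ zero) refl = refl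

classSize-miss : ∀ (τ : Fin (suc m) → Fin k) t → t ≢ τ zero → classSize τ t ≡ classSize (τ ∘ suc) t
classSize-miss τ t t≢ rewrite dec-false (τ zero Fin.≟ t) (t≢ ∘ sym) = refl

-- Induction on the ground set. Leaving out `zero` keeps `K`; taking it requires `τ zero ∈ K` and
-- leaves `K - τ zero`. Adding an element to a class changes the monomial by the same recurrence,
-- `weight-suc`.
numberOfTransversals : ∀ (τ : Fin m → Fin k) K →
                       numberOfSubsets (transversal? τ K) ≡ weight K (classSize τ)
numberOfTransversals {zero} τ K with Fin.any? (_∈? K)
... | yes (t , t∈K) = trans
  (numberOfSubsets-none (transversal? τ K) λ S tr → contradiction (proj₁ (surjective tr t t∈K)) λ ())
  (sym (weight-zero K t∈K refl))
... | no K-empty with refl ← Empty-unique K-empty = trans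
  (cong length (List.filter-all (transversal? τ K)
    (transversal (λ ()) (λ ()) (λ t t∈ → contradiction t∈ ∉⊥) ∷ [])))
  (sym (weight-∅ {f = classSize τ}))
numberOfTransversals {suc m} τ K = trans (numberOfSubsets-suc (transversal? τ K)) (trans
  (cong (_+ numberOfSubsets (transversal? τ K ∘ (inside ∷_)))
    (trans (numberOfSubsets-cong (transversal? τ K ∘ (outside ∷_)) (transversal? (τ ∘ suc) K)
             (transversal-outside⁻ , transversal-outside⁺))
           (numberOfTransversals (τ ∘ suc) K)))
  (rest (τ zero ∈? K)))
  where
  rest : Dec (τ zero ∈ K) → weight K (classSize (τ ∘ suc)) + numberOfSubsets (transversal? τ K ∘ (inside ∷_)) ≡ weight K (classSize τ)
  rest (yes t∈K) = trans
    (cong (weight K (classSize (τ ∘ suc)) ℕ.+_)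
      (trans (numberOfSubsets-cong (transversal? τ K ∘ (inside ∷_)) (transversal? (τ ∘ suc) (K - τ zero))
               (transversal-inside⁻ , transversal-inside⁺ t∈K))
             (numberOfTransversals (τ ∘ suc) (K - τ zero))))
    (sym (weight-suc K t∈K (classSize-hit τ) (classSize-miss τ)))
  rest (no t∉K) = trans
    (cong (weight K (classSize (τ ∘ suc)) ℕ.+_)
      (numberOfSubsets-none (transversal? τ K ∘ (inside ∷_)) λ S tr → t∉K (into tr zero here)))
    (trans (ℕ.+-identityʳ _)
      (weight-cong K λ t t∈K → sym (classSize-miss τ t λ { refl → t∉K t∈K })))

module _ {A : Set} (f : A → ℕ) where

  ∃-maximum : ∀ x xs → ∃ λ y → y List.∈ x ∷ xs × All (λ z → f z ≤ f y) (x ∷ xs)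
  ∃-maximum x [] = x , here refl , ℕ.≤-refl ∷ []
  ∃-maximum x (x′ ∷ xs) with ∃-maximum x′ xs
  ... | y , y∈ , max with ℕ.≤-total (f x) (f y)
  ...   | inj₁ x≤y = y , there y∈ , x≤y ∷ max
  ...   | inj₂ y≤x = x , here refl , ℕ.≤-refl ∷ All.map (λ z≤y → ℕ.≤-trans z≤y y≤x) max

-- Walks, components and cycles of a substructure.

module _ {n m : ℕ} (G : OrientedGraph n m) where

  open OrientedGraph G

  private
    variable
      u v w x y : Fin n
      e f       : Fin m

  joins-sym : Joins G e u v → Joins G e v u
  joins-sym = Sum.swap

  joins-incident : Joins G e u v → Incident G u e
  joins-incident (inj₁ (s , _)) = inj₁ s
  joins-incident (inj₂ (_ , t)) = inj₂ t

  joins-ends : Joins G e x y → Joins G e u v → (x ≡ u × y ≡ v) ⊎ (x ≡ v × y ≡ u)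
  joins-ends (inj₁ (refl , refl)) (inj₁ (refl , refl)) = inj₁ (refl , refl)
  joins-ends (inj₁ (refl , refl)) (inj₂ (refl , refl)) = inj₂ (refl , refl)
  joins-ends (inj₂ (refl , refl)) (inj₁ (refl , refl)) = inj₂ (refl , refl)
  joins-ends (inj₂ (refl , refl)) (inj₂ (refl , refl)) = inj₁ (refl , refl)

  joins-unique : Joins G e u v → Joins G f u v → e ≡ f
  joins-unique {e} {f = f} (inj₁ (s , t)) (inj₁ (s′ , t′)) = noMultiple e f (trans s (sym s′)) (trans t (sym t′))
  joins-unique {e} {f = f} (inj₁ (s , t)) (inj₂ (s′ , t′)) = contradiction (trans t (sym s′)) (noOpposite e f (trans s (sym t′)))
  joins-unique {e} {f = f} (inj₂ (s , t)) (inj₁ (s′ , t′)) = contradiction (trans t (sym s′)) (noOpposite e f (trans s (sym t′)))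
  joins-unique {e} {f = f} (inj₂ (s , t)) (inj₂ (s′ , t′)) = noMultiple e f (trans s (sym s′)) (trans t (sym t′))

  incident-joins : Incident G u e → ∃ λ v → Joins G e u v
  incident-joins {e = e} (inj₁ s) = target e , inj₁ (s , refl)
  incident-joins {e = e} (inj₂ t) = source e , inj₂ (refl , t)

  hasEndIn-joins : ∀ {S} → Joins G e u v → HasEndIn G S e → u ∈ S ⊎ v ∈ S
  hasEndIn-joins (inj₁ (refl , refl)) = id
  hasEndIn-joins (inj₂ (refl , refl)) = Sum.swap

  joins-hasEndIn : ∀ {S} → Joins G e u v → u ∈ S → HasEndIn G S e
  joins-hasEndIn (inj₁ (refl , _)) = inj₁
  joins-hasEndIn (inj₂ (_ , refl)) = inj₂

  isGraph-joins : ∀ {H} → IsGraph G H → e ∈ arcs H → Joins G e u v → u ∈ vertices H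
  isGraph-joins graph e∈ (inj₁ (refl , _)) = proj₁ (graph _ e∈)
  isGraph-joins graph e∈ (inj₂ (_ , refl)) = proj₂ (graph _ e∈)

  -- Walks, unlike the paths of Joined, compose without any loop erasure.
  module _ (H : Substructure n m) where

    Step : Fin n → Fin n → Set
    Step u v = u ∈ vertices H × v ∈ vertices H × Adjacent G H u v

    Walk : Fin n → Fin n → Set
    Walk = Star Step

    step-sym : Step u v → Step v u
    step-sym (u∈ , v∈ , e , e∈ , j) = v∈ , u∈ , e , e∈ , joins-sym j

    walk-sym : Walk u v → Walk v u
    walk-sym = reverse step-sym

  module _ {H : Substructure n m} where

    private
      V = vertices H

    path⇒walk : ∀ {xs} → IsPath G H u v xs → Walk H u v
    path⇒walk {xs = []} (_ , () , _)
    path⇒walk {xs = x ∷ []} (_ , refl , refl , _ , _) = ε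
    path⇒walk {xs = x ∷ y ∷ xs} (_ ∷ xs! , refl , l , x∈ ∷ y∈ ∷ xs∈ , a ∷ as) =
      (x∈ , y∈ , a) ◅ path⇒walk (xs! , refl , l , y∈ ∷ xs∈ , as)

    path-suffix : ∀ {x xs} → IsPath G H x v xs → u List.∈ xs → Joined G H u v
    path-suffix {xs = x ∷ xs} (xs! , refl , rest) (here refl) = x ∷ xs , xs! , refl , rest
    path-suffix {xs = x ∷ y ∷ xs} (_ ∷ xs! , _ , l , _ ∷ xs∈ , _ ∷ as) (there u∈) =
      path-suffix (xs! , refl , l , xs∈ , as) u∈

    -- Here the loops are erased: if `u` already lies on the path, its suffix from `u` serves, and
    -- otherwise `u` can be prepended without repetition.
    joined-step : Step H u x → Joined G H x v → Joined G H u v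
    joined-step {u = u} (u∈ , x∈ , a) (xs , p) with _∈ˡ?_ Fin._≟_ u xs
    ... | yes u∈xs = path-suffix p u∈xs
    joined-step {u = u} (u∈ , x∈ , a) ([] , _ , () , _) | no _
    joined-step {u = u} (u∈ , x∈ , a) (x ∷ xs , xs! , refl , l , xs∈ , as) | no u∉xs =
      u ∷ x ∷ xs , ¬Any⇒All¬ _ u∉xs ∷ xs! , refl , l , u∈ ∷ xs∈ , a ∷ as

    walk⇒joined : v ∈ V → Walk H u v → Joined G H u v
    walk⇒joined {v = v} v∈ ε = v ∷ [] , [] ∷ [] , refl , refl , v∈ ∷ [] , [-]
    walk⇒joined v∈ (s ◅ ss) = joined-step s (walk⇒joined v∈ ss)

    path-end : ∀ {xs} → IsPath G H u v xs → v ∈ V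
    path-end {xs = []} (_ , () , _)
    path-end {xs = x ∷ []} (_ , refl , refl , v∈ ∷ _ , _) = v∈
    path-end {xs = x ∷ y ∷ xs} (_ ∷ xs! , _ , l , _ ∷ xs∈ , _ ∷ as) =
      path-end {xs = y ∷ xs} (xs! , refl , l , xs∈ , as)

    ∈-component⁻ : u ∈ componentVertices G H v → u ∈ V × Walk H v u
    ∈-component⁻ {v = v} u∈ = let xs , p = ∈-subsetOf⁻ (joined? G H v) u∈ in path-end p , path⇒walk p

    ∈-component⁺ : u ∈ V → Walk H v u → u ∈ componentVertices G H v
    ∈-component⁺ {v = v} u∈ walk = ∈-subsetOf⁺ (joined? G H v) (walk⇒joined u∈ walk)

    component-closed : x ∈ componentVertices G H v → e ∈ arcs H → Joins G e x y → y ∈ V →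
                       y ∈ componentVertices G H v
    component-closed x∈ e∈ j y∈ = let x∈V , walk = ∈-component⁻ x∈ in
      ∈-component⁺ y∈ (walk ◅◅ (x∈V , y∈ , _ , e∈ , j) ◅ ε)

    ∈-componentArcs⁻ : e ∈ arcs (component G H v) → e ∈ arcs H × HasEndIn G (componentVertices G H v) e
    ∈-componentArcs⁻ e∈ = let e∈H , e∈′ = x∈p∩q⁻ (arcs H) _ e∈ in
      e∈H , ∈-subsetOf⁻ (hasEndIn? G _) e∈′

    ∈-componentArcs⁺ : e ∈ arcs H → Joins G e u w → u ∈ componentVertices G H v → e ∈ arcs (component G H v)
    ∈-componentArcs⁺ e∈ j u∈ = x∈p∩q⁺ (e∈ , ∈-subsetOf⁺ (hasEndIn? G _) (joins-hasEndIn j u∈))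

    module _ {P : Fin n → Set} where

      private
        TwoNeighbours : Fin n → Set
        TwoNeighbours x = ∃₂ λ y z → y ≢ z × (Adjacent G H x y × Adjacent G H x z) × (P y × P z)

        adjacent-sym : Adjacent G H x y → Adjacent G H y x
        adjacent-sym (e , e∈ , j) = e , e∈ , joins-sym j

        -- `p` is the predecessor of the remaining vertices on a cycle that starts at `u` and ends
        -- at `v`. The last vertex has neighbours `p` and `u`, so these must differ; at the start
        -- `p` is `u` itself, but then at least two vertices remain.
        inner : ∀ {u p v} ys → Unique (p ∷ ys) → Linked (Adjacent G H) (p ∷ ys) →
                last ys ≡ just v → Adjacent G H v u → All (u ≢_) ys → p ≢ u ⊎ 2 ≤ length ys →
                P u → All P (p ∷ ys) → x List.∈ ys → TwoNeighbours x
        inner (y ∷ []) _ (a ∷ _) refl c _ (inj₁ p≢u) Pu (Pp ∷ _) (here refl) =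
          _ , _ , p≢u , (adjacent-sym a , c) , (Pp , Pu)
        inner (y ∷ []) _ _ _ _ _ (inj₂ (s≤s ()))
        inner (y ∷ z ∷ zs) ((_ ∷ p≢z ∷ _) ∷ _) (a ∷ b ∷ _) l c _ _ Pu (Pp ∷ _ ∷ Pz ∷ _) (here refl) =
          _ , _ , p≢z , (adjacent-sym a , b) , (Pp , Pz)
        inner (y ∷ z ∷ zs) (_ ∷ ys!) (_ ∷ as) l c (u≢y ∷ u≢) _ Pu (_ ∷ Pys) (there x∈) =
          inner (z ∷ zs) ys! as l c u≢ (inj₁ (u≢y ∘ sym)) Pu Pys x∈

        last-∈ : ∀ (xs : List (Fin n)) → last xs ≡ just v → v List.∈ xs
        last-∈ (x ∷ [])     refl = here refl
        last-∈ (x ∷ y ∷ xs) l    = there (last-∈ (y ∷ xs) l)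

      -- `P` is a property known along the whole cycle, later a bound by a maximum, which thereby
      -- reaches both neighbours. Length at least three separates the second vertex from the last,
      -- the two neighbours of the first.
      cycle-two-neighbours : ∀ {xs} → IsCycle G H u v xs → All P xs → x List.∈ xs →
        ∃₂ λ y z → y ≢ z × (Adjacent G H x y × Adjacent G H x z) × (P y × P z)
      cycle-two-neighbours {xs = x ∷ []} (_ , s≤s () , _)
      cycle-two-neighbours {xs = x ∷ y ∷ []} (_ , s≤s (s≤s ()) , _)
      cycle-two-neighbours {xs = x ∷ y ∷ z ∷ zs} ((_ ∷ (y∉ ∷ _) , refl , l , _ , a ∷ _) , _ , c) (_ ∷ Py ∷ Pzs) (here refl) =
        _ , _ , All.lookup y∉ v∈ , (a , adjacent-sym c) , (Py , All.lookup Pzs v∈)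
        where v∈ = last-∈ (z ∷ zs) l
      cycle-two-neighbours {xs = x ∷ y ∷ z ∷ zs} ((xs!@(x∉ ∷ _) , refl , l , _ , as) , _ , c) Pxs@(Px ∷ _) (there x∈) =
        inner (y ∷ z ∷ zs) xs! as l c x∉ (inj₂ (s≤s (s≤s z≤n))) Px Pxs x∈

  -- Parent maps produce rootless forests.

  -- An orientation of the arcs of H towards the roots, recorded as the outgoing arc of each vertex.
  record ParentMap (H : Substructure n m) : Set where
    field
      parentArc   : Fin n → Fin m
      parent      : Fin n → Fin n
      depth       : Fin n → ℕ
      parentArc-∈ : v ∈ vertices H → parentArc v ∈ arcs H
      joins       : v ∈ vertices H → Joins G (parentArc v) v (parent v)
      depth-<     : v ∈ vertices H → parent v ∈ vertices H → depth (parent v) < depth v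
      onto        : e ∈ arcs H → ∃ λ v → v ∈ vertices H × e ≡ parentArc v

  module _ {H : Substructure n m} (pm : ParentMap H) where

    open ParentMap pm

    private
      V = vertices H

    arc-parent : e ∈ arcs H → Joins G e x y → (x ∈ V × e ≡ parentArc x × y ≡ parent x) ⊎ (y ∈ V × e ≡ parentArc y × x ≡ parent y)
    arc-parent e∈ j with onto e∈
    ... | z , z∈ , refl with joins-ends j (joins z∈)
    ...   | inj₁ (refl , refl) = inj₁ (z∈ , refl , refl)
    ...   | inj₂ (refl , refl) = inj₂ (z∈ , refl , refl)

    -- The root is the last vertex of the parent chain that still lies in `V`; the deleted leaf of
    -- the rootless tree is the parent of the root.
    data RootOf : Fin n → Fin n → Set where
      stop : parent v ∉ V → RootOf v v
      step : parent v ∈ V → RootOf (parent v) w → RootOf v w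

    root-∃ : v ∈ V → ∃ λ r → r ∈ V × RootOf v r
    root-∃ v∈ = go v∈ (<-wellFounded _)
      where
      go : v ∈ V → Acc _<_ (depth v) → ∃ λ r → r ∈ V × RootOf v r
      go {v} v∈ (acc rec) with parent v ∈? V
      ... | no  p∉ = v , v∈ , stop p∉
      ... | yes p∈ = let r , r∈ , root = go p∈ (rec (depth-< v∈ p∈)) in r , r∈ , step p∈ root

    root-outside : RootOf v w → parent w ∉ V
    root-outside (stop p∉)   = p∉
    root-outside (step _ rt) = root-outside rt

    root-walk : v ∈ V → RootOf v w → Walk H v w
    root-walk v∈ (stop _)    = ε
    root-walk v∈ (step p∈ rt) = (v∈ , p∈ , _ , parentArc-∈ v∈ , joins v∈) ◅ root-walk p∈ rt

    -- Each step runs along a parent arc, upwards or downwards, and neither changes where the parent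
    -- chain ends. Thus a component has only one root.
    root-invariant : Walk H u v → RootOf u w → RootOf v w
    root-invariant ε rt = rt
    root-invariant ((u∈ , x∈ , e , e∈ , j) ◅ ss) rt with arc-parent e∈ j
    ... | inj₂ (_ , _ , refl) = root-invariant ss (step u∈ rt)
    ... | inj₁ (_ , _ , refl) with rt
    ...   | stop p∉    = contradiction x∈ p∉
    ...   | step _ rt′ = root-invariant ss rt′

    root-unique : Walk H v u → RootOf v w → parent u ∉ V → u ≡ w
    root-unique walk rt p∉ with root-invariant walk rt
    ... | stop _    = refl
    ... | step p∈ _ = contradiction p∈ p∉

    private
      -- `depth` is unconstrained outside `V`. Level 0 there, and a shift by one inside, put every
      -- parent strictly below its child, the outer ones included.
      level : Fin n → ℕ
      level v with v ∈? V
      ... | yes _ = suc (depth v)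
      ... | no  _ = 0

      level-parent : v ∈ V → level (parent v) < level v
      level-parent {v} v∈ with v ∈? V | parent v ∈? V
      ... | no v∉ | _      = contradiction v∈ v∉
      ... | yes _ | yes p∈ = s≤s (depth-< v∈ p∈)
      ... | yes _ | no  _  = s≤s z≤n

    -- Both neighbours of a deepest vertex on a cycle would have to be its parent.
    parentMap-acyclic : ∀ {H′} → (∀ {e} → e ∈ arcs H′ → e ∈ arcs H) → ¬ HasCycle G H′
    parentMap-acyclic _ (u , v , [] , (_ , () , _) , _)
    parentMap-acyclic {H′} arcs⊆ (u , v , x ∷ xs , cyc) =
      let z , z∈ , max = ∃-maximum level x xs
          y , y′ , y≢y′ , (a , a′) , (y≤ , y′≤) = cycle-two-neighbours cyc max z∈
      in y≢y′ (trans (below a y≤) (sym (below a′ y′≤)))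
      where
      below : ∀ {z y} → Adjacent G H′ z y → level y ≤ level z → y ≡ parent z
      below (e , e∈ , j) y≤z with arc-parent (arcs⊆ e∈) j
      ... | inj₁ (_ , _ , eq)    = eq
      ... | inj₂ (y∈ , _ , refl) = contradiction y≤z (ℕ.<⇒≱ (level-parent y∈))

    private
      module Component {v r : Fin n} (v∈ : v ∈ V) (r∈ : r ∈ V) (root : RootOf v r) where

        C = componentVertices G H v
        -- The parent of the root is the leaf whose deletion turns the tree `T` into the component.
        w₀ = parent r
        T = addVertex G (component G H v) w₀

        C⊆V : x ∈ C → x ∈ V
        C⊆V = proj₁ ∘ ∈-component⁻

        v∈C : v ∈ C
        v∈C = ∈-component⁺ v∈ ε

        r∈C : r ∈ C
        r∈C = ∈-component⁺ r∈ (root-walk v∈ root)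

        w∉V : w₀ ∉ V
        w∉V = root-outside root

        root-of : x ∈ C → RootOf x r
        root-of x∈ = root-invariant (proj₂ (∈-component⁻ x∈)) root

        C⊆T : x ∈ C → x ∈ vertices T
        C⊆T x∈ = x∈p∪q⁺ (inj₁ x∈)

        w∈T : w₀ ∈ vertices T
        w∈T = x∈p∪q⁺ (inj₂ (x∈⁅x⁆ w₀))

        T⁻ : x ∈ vertices T → x ∈ C ⊎ x ≡ w₀
        T⁻ x∈ = Sum.map₂ (x∈⁅y⁆⇒x≡y w₀) (x∈p∪q⁻ C ⁅ w₀ ⁆ x∈)

        parent-C : x ∈ C → parent x ∈ V → parent x ∈ C
        parent-C x∈ = component-closed x∈ (parentArc-∈ (C⊆V x∈)) (joins (C⊆V x∈))

        parent-T : x ∈ C → parent x ∈ vertices T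
        parent-T {x} x∈ with parent x ∈? V
        ... | yes p∈ = C⊆T (parent-C x∈ p∈)
        -- A vertex of the component whose parent is outside is the root, so that parent is `w₀`.
        ... | no  p∉ = subst (λ x → parent x ∈ vertices T)
          (sym (root-unique (proj₂ (∈-component⁻ x∈)) root p∉)) w∈T

        parentArc-T : x ∈ C → parentArc x ∈ arcs T
        parentArc-T x∈ = ∈-componentArcs⁺ (parentArc-∈ (C⊆V x∈)) (joins (C⊆V x∈)) x∈

        arcs-T⁻ : e ∈ arcs T → ∃ λ x → x ∈ C × e ≡ parentArc x
        arcs-T⁻ e∈ with ∈-componentArcs⁻ e∈
        ... | e∈H , end with onto e∈H
        ...   | x , x∈ , refl with hasEndIn-joins (joins x∈) end
        ...     | inj₁ x∈C = x , x∈C , refl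
        ...     | inj₂ p∈C = x , component-closed p∈C e∈H (joins-sym (joins x∈)) x∈ , refl

        ends-T : Joins G e x y → x ∈ vertices T → y ∈ vertices T → source e ∈ vertices T × target e ∈ vertices T
        ends-T (inj₁ (refl , refl)) x∈ y∈ = x∈ , y∈
        ends-T (inj₂ (refl , refl)) x∈ y∈ = y∈ , x∈

        graph : IsGraph G T
        graph e e∈ with arcs-T⁻ e∈
        ... | x , x∈ , refl = ends-T (joins (C⊆V x∈)) (C⊆T x∈) (parent-T x∈)

        walk-up : x ∈ C → RootOf x r → Walk T x w₀
        walk-up x∈ (stop _) = (C⊆T x∈ , w∈T , _ , parentArc-T x∈ , joins (C⊆V x∈)) ◅ ε
        walk-up x∈ (step p∈ rt) =
          (C⊆T x∈ , parent-T x∈ , _ , parentArc-T x∈ , joins (C⊆V x∈)) ◅ walk-up (parent-C x∈ p∈) rt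

        walk-to-w : x ∈ vertices T → Walk T x w₀
        walk-to-w x∈ with T⁻ x∈
        ... | inj₁ x∈C  = walk-up x∈C (root-of x∈C)
        ... | inj₂ refl = ε

        connected : Connected G T
        connected = (w₀ , w∈T) , λ x x∈ y y∈ →
          walk⇒joined y∈ (walk-to-w x∈ ◅◅ walk-sym T (walk-to-w y∈))

        leaf : ∣ arcs T ∩ incidentArcs G w₀ ∣ ≡ 1
        leaf = ∣p∣≡1⁺ {x = parentArc r}
          (x∈p∩q⁺ (parentArc-T r∈C , ∈-subsetOf⁺ (incident? G w₀) (joins-incident (joins-sym (joins r∈)))))
          only
          where
          -- An arc of `T` at `w₀` is a parent arc whose upper end leaves `V`, and in this component
          -- only the root has one.
          only : e ∈ arcs T ∩ incidentArcs G w₀ → e ≡ parentArc r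
          only e∈∩ with x∈p∩q⁻ (arcs T) _ e∈∩
          ... | e∈ , e∈w with arcs-T⁻ e∈ | incident-joins (∈-subsetOf⁻ (incident? G w₀) e∈w)
          ...   | x , x∈ , refl | y , j with joins-ends j (joins (C⊆V x∈))
          ...     | inj₁ (refl , _) = contradiction (C⊆V x∈) w∉V
          ...     | inj₂ (w≡ , _) = cong parentArc
            (root-unique (proj₂ (∈-component⁻ x∈)) root (subst (_∉ V) w≡ w∉V))

        isRootlessTree : IsRootlessTree G (component G H v)
        isRootlessTree = (v , v∈C) , w₀ , w∉V ∘ C⊆V ,
          (graph , connected , parentMap-acyclic (proj₁ ∘ ∈-componentArcs⁻)) , w∈T , leaf

    parentMap⇒forest : IsRootlessForest G H
    parentMap⇒forest =
        (λ v v∈ → let r , r∈ , root = root-∃ v∈ in Component.isRootlessTree v∈ r∈ root)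
      , (λ e e∈ → let v , v∈ , e≡ = onto e∈ in
           joins-hasEndIn (subst (λ e → Joins G e v (parent v)) (sym e≡) (joins v∈)) v∈)

  -- Arcs of a rootless forest that leave its vertex set.

  module _ {H : Substructure n m} (forest : IsRootlessForest G H) where

    private
      V = vertices H

    -- Take the arc at the deleted leaf `w` of the component. Its other end must be in the
    -- component, and `w` in `V` would be absorbed by the component along this arc.
    root-arc-∃ : v ∈ V → ∃ λ e → e ∈ arcs H × ∃₂ λ u w → Joins G e u w × u ∈ V × w ∉ V
    root-arc-∃ {v} v∈ with proj₁ forest v v∈
    ... | _ , w , w∉C , _ , _ , one with ∣p∣≡1⇒nonempty one
    ... | e , e∈∩ with x∈p∩q⁻ (arcs (component G H v)) _ e∈∩
    ... | e∈ , e∈w with ∈-componentArcs⁻ e∈ | incident-joins (∈-subsetOf⁻ (incident? G w) e∈w)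
    ... | e∈H , end | u , j with hasEndIn-joins j end
    ... | inj₁ w∈C = contradiction w∈C w∉C
    ... | inj₂ u∈C = e , e∈H , u , w , joins-sym j , proj₁ (∈-component⁻ u∈C) ,
      λ w∈ → w∉C (component-closed u∈C e∈H (joins-sym j) w∈)

    -- Both arcs belong to the component of `u`. The ends of its arcs lie in the component or are
    -- the deleted leaf `r`, so both outer ends are `r`, which carries one arc only.
    root-arc-unique : Walk H u v → u ∈ V → v ∈ V → e ∈ arcs H → f ∈ arcs H →
                      Joins G e u w → Joins G f v x → w ∉ V → x ∉ V → e ≡ f
    root-arc-unique {u} {v} {e} {f} {w} {x} walk u∈ v∈ e∈ f∈ je jf w∉ x∉ with proj₁ forest u u∈
    ... | _ , r , r∉C , (graph , _) , _ , one = ∣p∣≡1⇒unique one (at-r e∈C je w∉) (at-r f∈C jf x∉)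
      where
      C = componentVertices G H u

      e∈C : e ∈ arcs (component G H u)
      e∈C = ∈-componentArcs⁺ e∈ je (∈-component⁺ u∈ ε)

      f∈C : f ∈ arcs (component G H u)
      f∈C = ∈-componentArcs⁺ f∈ jf (∈-component⁺ v∈ walk)

      at-r : ∀ {g y z} → g ∈ arcs (component G H u) → Joins G g y z → z ∉ V →
             g ∈ arcs (component G H u) ∩ incidentArcs G r
      at-r g∈ j z∉ with x∈p∪q⁻ C ⁅ r ⁆ (isGraph-joins graph g∈ (joins-sym j))
      ... | inj₁ z∈C = contradiction (proj₁ (∈-component⁻ z∈C)) z∉
      ... | inj₂ z∈r with refl ← x∈⁅y⁆⇒x≡y r z∈r =
        x∈p∩q⁺ (g∈ , ∈-subsetOf⁺ (incident? G r) (joins-incident (joins-sym j)))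

∈⁅⁆∪⁅⁆∪⁅⁆⁻ : ∀ {k} {x} (a b c : Fin k) → x ∈ ⁅ a ⁆ ∪ ⁅ b ⁆ ∪ ⁅ c ⁆ → x ≡ a ⊎ x ≡ b ⊎ x ≡ c
∈⁅⁆∪⁅⁆∪⁅⁆⁻ a b c x∈ = Sum.map (x∈⁅y⁆⇒x≡y a)
  (Sum.map (x∈⁅y⁆⇒x≡y b) (x∈⁅y⁆⇒x≡y c) ∘ x∈p∪q⁻ ⁅ b ⁆ ⁅ c ⁆) (x∈p∪q⁻ ⁅ a ⁆ (⁅ b ⁆ ∪ ⁅ c ⁆) x∈)

∈⁅⁆∪⁅⁆∪⁅⁆⁺ : ∀ {k} {x} (a b c : Fin k) → x ≡ a ⊎ x ≡ b ⊎ x ≡ c → x ∈ ⁅ a ⁆ ∪ ⁅ b ⁆ ∪ ⁅ c ⁆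
∈⁅⁆∪⁅⁆∪⁅⁆⁺ a b c (inj₁ refl)        = x∈p∪q⁺ (inj₁ (x∈⁅x⁆ a))
∈⁅⁆∪⁅⁆∪⁅⁆⁺ a b c (inj₂ (inj₁ refl)) = x∈p∪q⁺ {p = ⁅ a ⁆} (inj₂ (x∈p∪q⁺ (inj₁ (x∈⁅x⁆ b))))
∈⁅⁆∪⁅⁆∪⁅⁆⁺ a b c (inj₂ (inj₂ refl)) = x∈p∪q⁺ {p = ⁅ a ⁆} (inj₂ (x∈p∪q⁺ {p = ⁅ b ⁆} (inj₂ (x∈⁅x⁆ c))))

-- Edges, triangles and spanning trees of K₄.

-- The edges of K₄ with vertices 0, 1, 2, 3; the junk value 0 marks the pairs that are not edges.
edge : Fin 4 → Fin 4 → Fin 7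
edge i j = lookup (lookup table i) j
  where
  table : Vec (Vec (Fin 7) 4) 4
  table = (# 0 ∷ # 1 ∷ # 2 ∷ # 3 ∷ [])
        ∷ (# 1 ∷ # 0 ∷ # 4 ∷ # 5 ∷ [])
        ∷ (# 2 ∷ # 4 ∷ # 0 ∷ # 6 ∷ [])
        ∷ (# 3 ∷ # 5 ∷ # 6 ∷ # 0 ∷ [])
        ∷ []

-- The finite checks are abstract so that they are not evaluated again when used.
abstract

  edge-sym : ∀ i j → edge i j ≡ edge j i
  edge-sym = from-yes (Fin.all? λ i → Fin.all? λ j → edge i j Fin.≟ edge j i)

  edge-nonzero : ∀ i j → i ≢ j → edge i j ≢ zero
  edge-nonzero = from-yes (Fin.all? λ i → Fin.all? λ j → ¬? (i Fin.≟ j) →-dec ¬? (edge i j Fin.≟ zero))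

  edge-injective : ∀ i j k l → i ≢ j → edge k l ≡ edge i j → (k ≡ i × l ≡ j) ⊎ (k ≡ j × l ≡ i)
  edge-injective = from-yes (Fin.all? λ i → Fin.all? λ j → Fin.all? λ k → Fin.all? λ l →
    ¬? (i Fin.≟ j) →-dec edge k l Fin.≟ edge i j →-dec
    ((k Fin.≟ i ×-dec l Fin.≟ j) ⊎-dec (k Fin.≟ j ×-dec l Fin.≟ i)))

-- Edges 4, 5 and 6 are those that avoid the vertex 0.
triangle : Subset 7
triangle = outside ∷ outside ∷ outside ∷ outside ∷ inside ∷ inside ∷ inside ∷ []

abstract

  edge-∈-triangle : ∀ (i j : Fin 3) → i ≢ j → edge (suc i) (suc j) ∈ triangle
  edge-∈-triangle = from-yes (Fin.all? λ i → Fin.all? λ j → ¬? (i Fin.≟ j) →-dec edge (suc i) (suc j) ∈? triangle)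

  triangle-edges : ∀ (i j k : Fin 3) → i ≢ j → j ≢ k → k ≢ i → ∀ t → t ∈ triangle →
    edge (suc i) (suc j) ≡ t ⊎ edge (suc j) (suc k) ≡ t ⊎ edge (suc k) (suc i) ≡ t
  triangle-edges = from-yes (Fin.all? λ i → Fin.all? λ j → Fin.all? λ k →
    ¬? (i Fin.≟ j) →-dec ¬? (j Fin.≟ k) →-dec ¬? (k Fin.≟ i) →-dec Fin.all? λ t → t ∈? triangle →-dec
    (edge (suc i) (suc j) Fin.≟ t ⊎-dec edge (suc j) (suc k) Fin.≟ t ⊎-dec edge (suc k) (suc i) Fin.≟ t))

-- Spanning trees of K₄ are given by their orientation towards the vertex 0: entry i is the parent of suc i.
Parents : Set
Parents = Vec (Fin 4) 3

-- Truncated at 3, which only a cyclic orientation reaches.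
height : Parents → Fin 3 → ℕ
height p = go 3
  where
  go : ℕ → Fin 3 → ℕ
  go zero    i = 0
  go (suc k) i with lookup p i
  ... | zero  = 0
  ... | suc j = suc (go k j)

-- On a directed cycle every height is the truncated 3, so the strict decrease fails there. For a
-- tree, `height` later serves as the depth of a parent map.
Acyclic : Parents → Set
Acyclic p = ∀ i j → lookup p i ≡ suc j → height p j < height p i

acyclic? : Decidable Acyclic
acyclic? p = Fin.all? λ i → Fin.all? λ j → lookup p i Fin.≟ suc j →-dec height p j ℕ.<? height p i

acyclic-irreflexive : ∀ {p} → Acyclic p → ∀ i → suc i ≢ lookup p i
acyclic-irreflexive acyc i eq = ℕ.<-irrefl refl (acyc i i (sym eq))

treeEdges : Parents → Subset 7
treeEdges p = subsetOf λ t → Fin.any? λ i → edge (suc i) (lookup p i) Fin.≟ t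

∈-treeEdges⁺ : ∀ p i → edge (suc i) (lookup p i) ∈ treeEdges p
∈-treeEdges⁺ p i = ∈-subsetOf⁺ (λ t → Fin.any? λ i → edge (suc i) (lookup p i) Fin.≟ t) (i , refl)

∈-treeEdges⁻ : ∀ p {t} → t ∈ treeEdges p → ∃ λ i → edge (suc i) (lookup p i) ≡ t
∈-treeEdges⁻ p = ∈-subsetOf⁻ (λ t → Fin.any? λ i → edge (suc i) (lookup p i) Fin.≟ t)

allParents : List Parents
allParents = cons (cons (cons ([] ∷ [])))
  where
  cons : ∀ {k} → List (Vec (Fin 4) k) → List (Vec (Fin 4) (suc k))
  cons = cartesianProductWith _∷_ (allFin 4)

spanningTrees : List (Subset 7)
spanningTrees = List.map treeEdges (filter acyclic? allParents)

abstract

  -- A tree has one orientation towards the vertex 0, so it is listed once.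
  spanningTrees-unique : Unique spanningTrees
  spanningTrees-unique = from-yes (unique? _≟ˢ_ spanningTrees)

∈-spanningTrees⁻ : ∀ {K} → K List.∈ spanningTrees → ∃ λ p → Acyclic p × K ≡ treeEdges p
∈-spanningTrees⁻ K∈ = let p , p∈ , K≡ = ∈-map⁻ treeEdges {xs = filter acyclic? allParents} K∈ in
  p , proj₂ (∈-filter⁻ acyclic? {xs = allParents} p∈) , K≡

abstract

  ∣spanningTree∣≡3 : ∀ {K} → K List.∈ spanningTrees → ∣ K ∣ ≡ 3
  ∣spanningTree∣≡3 = All.lookup (from-yes (All.all? (λ K → ∣ K ∣ ℕ.≟ 3) spanningTrees))

RootsSeparated : Subset 7 → Set
RootsSeparated K = ∀ (i j : Fin 3) → i ≢ j → edge (suc i) zero ∈ K → edge (suc j) zero ∈ K → edge (suc i) (suc j) ∉ K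

HasRoot : Subset 7 → Set
HasRoot K = ∃ λ (i : Fin 3) → edge (suc i) zero ∈ K

abstract

  -- Three edges of K₄ fail to be a spanning tree only if they form a triangle. A root edge excludes
  -- the triangle avoiding 0, separated roots exclude the three through 0. The check runs over all
  -- 128 subsets.
  ∈-spanningTrees⁺ : ∀ {K} → ∣ K ∣ ≡ 3 → zero ∉ K → HasRoot K → RootsSeparated K → K List.∈ spanningTrees
  ∈-spanningTrees⁺ {K} three 0∉K root separated =
    decidable-stable (_∈ˡ?_ _≟ˢ_ K spanningTrees) λ K∉ → none (K , three , 0∉K , root , separated , K∉)
    where
    none : ¬ ∃ λ K → ∣ K ∣ ≡ 3 × zero ∉ K × HasRoot K × RootsSeparated K × ¬ K List.∈ spanningTrees
    none = from-no (anySubset? λ K → ∣ K ∣ ℕ.≟ 3 ×-dec ¬? (zero ∈? K)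
      ×-dec (Fin.any? λ (i : Fin 3) → edge (suc i) zero ∈? K)
      ×-dec (Fin.all? λ (i : Fin 3) → Fin.all? λ (j : Fin 3) → ¬? (i Fin.≟ j) →-dec
             edge (suc i) zero ∈? K →-dec edge (suc j) zero ∈? K →-dec ¬? (edge (suc i) (suc j) ∈? K))
      ×-dec ¬? (_∈ˡ?_ _≟ˢ_ K spanningTrees))

-- Contraction to K₄: forests and triangles as transversals.

module Contraction {n m : ℕ} (G : OrientedGraph n m) (V′ : Subset n) (ι : Fin 3 → Fin n)
  (ι-injective : ∀ {i j} → ι i ≡ ι j → i ≡ j) (ι-∈ : ∀ i → ι i ∈ V′)
  (ι-surjective : ∀ {v} → v ∈ V′ → ∃ λ i → ι i ≡ v) where

  open OrientedGraph G

  private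
    variable
      u v w x y : Fin n
      e f       : Fin m
      i j       : Fin 3
      S         : Subset m

  -- Contracts the complement of V′ to the vertex 0 of K₄.
  vertexClass : Fin n → Fin 4
  vertexClass v with v ∈? V′
  ... | yes v∈ = suc (proj₁ (ι-surjective v∈))
  ... | no  _  = zero

  vertexClass-ι : ∀ i → vertexClass (ι i) ≡ suc i
  vertexClass-ι i with ι i ∈? V′
  ... | yes v∈ = cong suc (ι-injective (proj₂ (ι-surjective v∈)))
  ... | no  v∉ = contradiction (ι-∈ i) v∉

  vertexClass-∉ : v ∉ V′ → vertexClass v ≡ zero
  vertexClass-∉ {v} v∉ with v ∈? V′
  ... | yes v∈ = contradiction v∈ v∉
  ... | no  _  = refl

  vertexClass-suc⁻ : vertexClass v ≡ suc i → v ≡ ι i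
  vertexClass-suc⁻ {v} eq with v ∈? V′
  vertexClass-suc⁻ refl | yes v∈ = sym (proj₂ (ι-surjective v∈))

  vertexClass-zero⁻ : vertexClass v ≡ zero → v ∉ V′
  vertexClass-zero⁻ {v} eq with v ∈? V′
  vertexClass-zero⁻ () | yes v∈
  vertexClass-zero⁻ eq | no  v∉ = v∉

  arcClass : Fin m → Fin 7
  arcClass e = edge (vertexClass (source e)) (vertexClass (target e))

  arcClass-joins : Joins G e u v → arcClass e ≡ edge (vertexClass u) (vertexClass v)
  arcClass-joins (inj₁ (refl , refl)) = refl
  arcClass-joins {e} (inj₂ (refl , refl)) = edge-sym (vertexClass (source e)) _

  arcClass-ι : Joins G e (ι i) v → arcClass e ≡ edge (suc i) (vertexClass v)
  arcClass-ι {i = i} {v} j = trans (arcClass-joins j) (cong (λ c → edge c (vertexClass v)) (vertexClass-ι i))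

  arcClass-ιι : Joins G e (ι i) (ι j) → arcClass e ≡ edge (suc i) (suc j)
  arcClass-ιι {i = i} {j} je = trans (arcClass-ι je) (cong (edge (suc i)) (vertexClass-ι j))

  arcClass⁻ : ∀ {c d} → c ≢ d → arcClass e ≡ edge c d →
              ∃₂ λ u v → Joins G e u v × vertexClass u ≡ c × vertexClass v ≡ d
  arcClass⁻ {e} {c} {d} c≢d eq with edge-injective c d (vertexClass (source e)) (vertexClass (target e)) c≢d eq
  ... | inj₁ (s , t) = source e , target e , inj₁ (refl , refl) , s , t
  ... | inj₂ (s , t) = target e , source e , inj₂ (refl , refl) , t , s

  arcClass-ι⁻ : ∀ {d} → suc i ≢ d → arcClass e ≡ edge (suc i) d →
                ∃ λ w → Joins G e (ι i) w × vertexClass w ≡ d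
  arcClass-ι⁻ i≢d eq with arcClass⁻ i≢d eq
  ... | u , w , je , cu , cw with refl ← vertexClass-suc⁻ cu = w , je , cw

  arcClass-root⁻ : arcClass e ≡ edge (suc i) zero → ∃ λ w → Joins G e (ι i) w × w ∉ V′
  arcClass-root⁻ eq = let w , je , cw = arcClass-ι⁻ (λ ()) eq in w , je , vertexClass-zero⁻ cw

  arcClass-side⁻ : i ≢ j → arcClass e ≡ edge (suc i) (suc j) → Joins G e (ι i) (ι j)
  arcClass-side⁻ i≢j eq with arcClass⁻ (i≢j ∘ Fin.suc-injective) eq
  ... | u , w , je , cu , cw with refl ← vertexClass-suc⁻ cu | refl ← vertexClass-suc⁻ cw = je

  side-unique : i ≢ j → arcClass e ≡ edge (suc i) (suc j) → arcClass f ≡ edge (suc i) (suc j) → e ≡ f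
  side-unique i≢j eq eq′ = joins-unique G (arcClass-side⁻ i≢j eq) (arcClass-side⁻ i≢j eq′)

  joins-ι≢ : Joins G e (ι i) v → suc i ≢ vertexClass v
  joins-ι≢ {e} (inj₁ (s , t)) eq = noLoops e (trans s (trans (sym (vertexClass-suc⁻ (sym eq))) (sym t)))
  joins-ι≢ {e} (inj₂ (s , t)) eq = noLoops e (trans s (trans (vertexClass-suc⁻ (sym eq)) (sym t)))

  hasEndIn-ι : HasEndIn G V′ e → ∃₂ λ i v → Joins G e (ι i) v
  hasEndIn-ι {e} (inj₁ s∈) = let i , eq = ι-surjective s∈ in i , target e , inj₁ (sym eq , refl)
  hasEndIn-ι {e} (inj₂ t∈) = let i , eq = ι-surjective t∈ in i , source e , inj₂ (refl , sym eq)

  module _ {p : Parents} (acyc : Acyclic p) (tr : Transversal arcClass (treeEdges p) S) where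

    private
      pick : ∀ i → ∃ λ e → e ∈ S × arcClass e ≡ edge (suc i) (lookup p i)
      pick i = surjective tr _ (∈-treeEdges⁺ p i)

      arc : Fin 3 → Fin m
      arc i = proj₁ (pick i)

      end : ∀ i → ∃ λ w → Joins G (arc i) (ι i) w × vertexClass w ≡ lookup p i
      end i = arcClass-ι⁻ (acyclic-irreflexive acyc i) (proj₂ (proj₂ (pick i)))

      -- Values at the class 0 are junk.
      onClass : {A : Set} → A → (Fin 3 → A) → Fin 4 → A
      onClass a g zero    = a
      onClass a g (suc i) = g i

      onClass-ι : {A : Set} (a : A) (g : Fin 3 → A) → ∀ i → onClass a g (vertexClass (ι i)) ≡ g i
      onClass-ι a g i = cong (onClass a g) (vertexClass-ι i)

      parentArc = onClass (arc zero) arc ∘ vertexClass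
      parent    = onClass (ι zero) (proj₁ ∘ end) ∘ vertexClass
      depth     = onClass 0 (height p) ∘ vertexClass

      depth-end : ∀ i {w} → vertexClass w ≡ lookup p i → (∃ λ j → ι j ≡ w) → depth w < height p i
      depth-end i cw (j , refl) =
        subst (_< height p i) (sym (onClass-ι 0 (height p) j)) (acyc i j (trans (sym cw) (vertexClass-ι j)))

      arc-∈ : ∀ {v} → (∃ λ i → ι i ≡ v) → parentArc v ∈ S
      arc-∈ (i , refl) = subst (_∈ S) (sym (onClass-ι (arc zero) arc i)) (proj₁ (proj₂ (pick i)))

      arc-joins : ∀ {v} → (∃ λ i → ι i ≡ v) → Joins G (parentArc v) v (parent v)
      arc-joins (i , refl) =
        -- `vertexClass (ι i)` does not compute, so the fact is transported from the class `suc i`,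
        -- where `onClass` does.
        subst (λ c → Joins G (onClass (arc zero) arc c) (ι i) (onClass (ι zero) (proj₁ ∘ end) c))
              (sym (vertexClass-ι i)) (proj₁ (proj₂ (end i)))

      parent-depth : ∀ {v} → (∃ λ i → ι i ≡ v) → parent v ∈ V′ → depth (parent v) < depth v
      parent-depth (i , refl) =
        subst (λ c → onClass (ι zero) (proj₁ ∘ end) c ∈ V′ →
                     depth (onClass (ι zero) (proj₁ ∘ end) c) < onClass 0 (height p) c)
              (sym (vertexClass-ι i)) (λ w∈ → depth-end i (proj₂ (proj₂ (end i))) (ι-surjective w∈))

      onto : ∀ {e} → e ∈ S → ∃ λ v → v ∈ V′ × e ≡ parentArc v
      onto {e} e∈ = let i , eq = ∈-treeEdges⁻ p (into tr e e∈) in ι i , ι-∈ i , trans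
        (injective tr e e∈ (arc i) (proj₁ (proj₂ (pick i))) (trans (sym eq) (sym (proj₂ (proj₂ (pick i))))))
        (sym (onClass-ι (arc zero) arc i))

    spanningTree⇒parentMap : ParentMap G ⟨ V′ , S ⟩
    spanningTree⇒parentMap = record
      { parentArc   = parentArc
      ; parent      = parent
      ; depth       = depth
      ; parentArc-∈ = λ v∈ → arc-∈ (ι-surjective v∈)
      ; joins       = λ v∈ → arc-joins (ι-surjective v∈)
      ; depth-<     = λ v∈ → parent-depth (ι-surjective v∈)
      ; onto        = λ {e} → onto {e}
      }

  module _ (forest : IsRootlessForest G ⟨ V′ , S ⟩) where

    private
      H = ⟨ V′ , S ⟩

      imageClass? = λ t → Fin.any? λ e → e ∈? S ×-dec arcClass e Fin.≟ t
      -- The candidate for the spanning tree: all classes that `S` meets.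
      K = subsetOf imageClass?

      -- Arcs of one class share an end `ι i`. If the class is at 0, both leave `V′` there and the
      -- empty walk feeds `root-arc-unique`; otherwise they join the same two vertices, and `G` is
      -- simple.
      arcClass-injective : ∀ e → e ∈ S → ∀ f → f ∈ S → arcClass e ≡ arcClass f → e ≡ f
      arcClass-injective e e∈ f f∈ eq =
        let i , v , je = hasEndIn-ι (proj₂ forest e e∈)
            v′ , jf , cv′ = arcClass-ι⁻ (joins-ι≢ je) (trans (sym eq) (arcClass-ι je))
        in by-class je jf (vertexClass v) refl cv′
        where
        by-class : ∀ {i v v′} → Joins G e (ι i) v → Joins G f (ι i) v′ →
                   ∀ d → vertexClass v ≡ d → vertexClass v′ ≡ vertexClass v → e ≡ f
        by-class {i} je jf zero cv cv′ = root-arc-unique G forest ε (ι-∈ i) (ι-∈ i) e∈ f∈ je jf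
          (vertexClass-zero⁻ cv) (vertexClass-zero⁻ (trans cv′ cv))
        by-class je jf (suc j) cv cv′
          with refl ← vertexClass-suc⁻ cv | refl ← vertexClass-suc⁻ (trans cv′ cv) = joins-unique G je jf

      image-transversal : Transversal arcClass K S
      image-transversal = transversal arcClass-injective
        (λ e e∈ → ∈-subsetOf⁺ imageClass? (e , e∈ , refl))
        (λ t t∈ → ∈-subsetOf⁻ imageClass? t∈)

      no-zero : zero ∉ K
      no-zero 0∈ with ∈-subsetOf⁻ imageClass? 0∈
      ... | e , e∈ , eq with hasEndIn-ι (proj₂ forest e e∈)
      ... | i , v , je = edge-nonzero _ _ (joins-ι≢ je) (trans (sym (arcClass-ι je)) eq)

      hasRoot : HasRoot K
      hasRoot with root-arc-∃ G forest (ι-∈ zero)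
      ... | e , e∈ , u , w , je , u∈ , w∉ with ι-surjective u∈
      ... | i , refl = i , ∈-subsetOf⁺ imageClass?
        (e , e∈ , trans (arcClass-ι je) (cong (edge (suc i)) (vertexClass-∉ w∉)))

      -- The arc between `ι i` and `ι j` is a walk, so the two arcs leaving `V′` from its ends would
      -- coincide, although their classes differ.
      rootsSeparated : RootsSeparated K
      rootsSeparated i j i≢j ri rj ij
        with ∈-subsetOf⁻ imageClass? ri | ∈-subsetOf⁻ imageClass? rj | ∈-subsetOf⁻ imageClass? ij
      ... | e , e∈ , ce | f , f∈ , cf | g , g∈ , cg with arcClass-root⁻ ce | arcClass-root⁻ cf
      ... | w , je , w∉ | w′ , jf , w′∉
        with refl ← root-arc-unique G forest ((ι-∈ i , ι-∈ j , g , g∈ , arcClass-side⁻ i≢j cg) ◅ ε)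
                      (ι-∈ i) (ι-∈ j) e∈ f∈ je jf w∉ w′∉
        with edge-injective (suc i) zero (suc j) zero (λ ()) (trans (sym cf) ce)
      ... | inj₁ (refl , _) = i≢j refl
      ... | inj₂ (() , _)

    forest⇒spanningTree : ∣ S ∣ ≡ 3 → Any (λ K → Transversal arcClass K S) spanningTrees
    forest⇒spanningTree three = lose
      (∈-spanningTrees⁺ (trans (sym (transversal-∣∣ image-transversal)) three) no-zero hasRoot rootsSeparated)
      image-transversal

  numberOfForests : numberOfRootlessForests G V′ 3 ≡
                    ListAction.sum (List.map (λ K → weight K (classSize arcClass)) spanningTrees)
  numberOfForests = trans
    (numberOfSubsets-cong
      (λ S → ∣ S ∣ ℕ.≟ 3 ×-dec isRootlessForest? G ⟨ V′ , S ⟩)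
      (λ S → Any.any? (λ K → transversal? arcClass K S) spanningTrees)
      ((λ (three , forest) → forest⇒spanningTree forest three) , λ any → spanningTree⇒forest (find any)))
    (trans (numberOfSubsets-Any (transversal? arcClass) transversal-unique spanningTrees-unique)
           (cong ListAction.sum (List.map-cong (numberOfTransversals arcClass) spanningTrees)))
    where
    spanningTree⇒forest : (∃ λ K → K List.∈ spanningTrees × Transversal arcClass K S) →
                          ∣ S ∣ ≡ 3 × IsRootlessForest G ⟨ V′ , S ⟩
    spanningTree⇒forest (K , K∈ , tr) with ∈-spanningTrees⁻ K∈
    ... | p , acyc , refl = trans (transversal-∣∣ tr) (∣spanningTree∣≡3 K∈) ,
      parentMap⇒forest G (spanningTree⇒parentMap acyc tr)

  triangle⁻ : IsTriangle G ⟨ V′ , S ⟩ → Transversal arcClass triangle S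
  triangle⁻ (a , b , c , e , f , g , (a≢b , b≢c , c≢a) , refl , (je , jf , jg) , refl)
    with ι-surjective (∈⁅⁆∪⁅⁆∪⁅⁆⁺ a b c (inj₁ refl))
       | ι-surjective (∈⁅⁆∪⁅⁆∪⁅⁆⁺ a b c (inj₂ (inj₁ refl)))
       | ι-surjective (∈⁅⁆∪⁅⁆∪⁅⁆⁺ a b c (inj₂ (inj₂ refl)))
  ... | i , refl | j , refl | k , refl = transversal distinct inside-triangle covers
    where
    i≢j = a≢b ∘ cong ι
    j≢k = b≢c ∘ cong ι
    k≢i = c≢a ∘ cong ι
    E′ = ⁅ e ⁆ ∪ ⁅ f ⁆ ∪ ⁅ g ⁆

    side : ∀ {h} → h ≡ e ⊎ h ≡ f ⊎ h ≡ g → ∃₂ λ r s → r ≢ s × arcClass h ≡ edge (suc r) (suc s)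
    side (inj₁ refl)        = i , j , i≢j , arcClass-ιι je
    side (inj₂ (inj₁ refl)) = j , k , j≢k , arcClass-ιι jf
    side (inj₂ (inj₂ refl)) = k , i , k≢i , arcClass-ιι jg

    distinct : ∀ h → h ∈ E′ → ∀ h′ → h′ ∈ E′ → arcClass h ≡ arcClass h′ → h ≡ h′
    distinct h h∈ h′ h′∈ eq with side (∈⁅⁆∪⁅⁆∪⁅⁆⁻ e f g h∈)
    ... | r , s , r≢s , ch = side-unique r≢s ch (trans (sym eq) ch)

    inside-triangle : ∀ h → h ∈ E′ → arcClass h ∈ triangle
    inside-triangle h h∈ with side (∈⁅⁆∪⁅⁆∪⁅⁆⁻ e f g h∈)
    ... | r , s , r≢s , ch = subst (_∈ triangle) (sym ch) (edge-∈-triangle r s r≢s)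

    covers : ∀ t → t ∈ triangle → ∃ λ h → h ∈ E′ × arcClass h ≡ t
    covers t t∈ with triangle-edges i j k i≢j j≢k k≢i t t∈
    ... | inj₁ refl        = e , ∈⁅⁆∪⁅⁆∪⁅⁆⁺ e f g (inj₁ refl)        , arcClass-ιι je
    ... | inj₂ (inj₁ refl) = f , ∈⁅⁆∪⁅⁆∪⁅⁆⁺ e f g (inj₂ (inj₁ refl)) , arcClass-ιι jf
    ... | inj₂ (inj₂ refl) = g , ∈⁅⁆∪⁅⁆∪⁅⁆⁺ e f g (inj₂ (inj₂ refl)) , arcClass-ιι jg

  triangle⁺ : Transversal arcClass triangle S → IsTriangle G ⟨ V′ , S ⟩
  triangle⁺ {S} tr = a , b , c , e₁ , e₂ , e₃ , (i≢j ∘ ι-injective , j≢k ∘ ι-injective , k≢i ∘ ι-injective) ,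
      ⊆-antisym (λ v∈ → ∈⁅⁆∪⁅⁆∪⁅⁆⁺ a b c (vertex (ι-surjective v∈)))
                (λ v∈ → vertex⁻ (∈⁅⁆∪⁅⁆∪⁅⁆⁻ a b c v∈)) ,
      (arcClass-side⁻ i≢j c₁ , arcClass-side⁻ j≢k c₂ , arcClass-side⁻ k≢i c₃) ,
      ⊆-antisym (λ h∈ → ∈⁅⁆∪⁅⁆∪⁅⁆⁺ e₁ e₂ e₃ (arc h∈)) (λ h∈ → arc⁻ (∈⁅⁆∪⁅⁆∪⁅⁆⁻ e₁ e₂ e₃ h∈))
    where
    i₀ j₀ k₀ : Fin 3
    i₀ = zero
    j₀ = suc zero
    k₀ = suc (suc zero)

    i≢j : i₀ ≢ j₀
    i≢j ()

    j≢k : j₀ ≢ k₀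
    j≢k ()

    k≢i : k₀ ≢ i₀
    k≢i ()

    a = ι i₀
    b = ι j₀
    c = ι k₀

    pick : ∀ i j → i ≢ j → ∃ λ e → e ∈ S × arcClass e ≡ edge (suc i) (suc j)
    pick i j i≢j = surjective tr _ (edge-∈-triangle i j i≢j)

    e₁ = proj₁ (pick i₀ j₀ i≢j)
    e₂ = proj₁ (pick j₀ k₀ j≢k)
    e₃ = proj₁ (pick k₀ i₀ k≢i)
    e₁∈ = proj₁ (proj₂ (pick i₀ j₀ i≢j))
    e₂∈ = proj₁ (proj₂ (pick j₀ k₀ j≢k))
    e₃∈ = proj₁ (proj₂ (pick k₀ i₀ k≢i))
    c₁ = proj₂ (proj₂ (pick i₀ j₀ i≢j))
    c₂ = proj₂ (proj₂ (pick j₀ k₀ j≢k))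
    c₃ = proj₂ (proj₂ (pick k₀ i₀ k≢i))

    vertex : (∃ λ i → ι i ≡ v) → v ≡ a ⊎ v ≡ b ⊎ v ≡ c
    vertex (zero           , refl) = inj₁ refl
    vertex (suc zero       , refl) = inj₂ (inj₁ refl)
    vertex (suc (suc zero) , refl) = inj₂ (inj₂ refl)

    vertex⁻ : v ≡ a ⊎ v ≡ b ⊎ v ≡ c → v ∈ V′
    vertex⁻ (inj₁ refl)        = ι-∈ i₀
    vertex⁻ (inj₂ (inj₁ refl)) = ι-∈ j₀
    vertex⁻ (inj₂ (inj₂ refl)) = ι-∈ k₀

    arc : ∀ {h} → h ∈ S → h ≡ e₁ ⊎ h ≡ e₂ ⊎ h ≡ e₃
    arc {h} h∈ with triangle-edges i₀ j₀ k₀ i≢j j≢k k≢i (arcClass h) (into tr h h∈)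
    ... | inj₁ eq        = inj₁ (side-unique i≢j (sym eq) c₁)
    ... | inj₂ (inj₁ eq) = inj₂ (inj₁ (side-unique j≢k (sym eq) c₂))
    ... | inj₂ (inj₂ eq) = inj₂ (inj₂ (side-unique k≢i (sym eq) c₃))

    arc⁻ : ∀ {h} → h ≡ e₁ ⊎ h ≡ e₂ ⊎ h ≡ e₃ → h ∈ S
    arc⁻ (inj₁ refl)        = e₁∈
    arc⁻ (inj₂ (inj₁ refl)) = e₂∈
    arc⁻ (inj₂ (inj₂ refl)) = e₃∈

  numberOfTriangles≡ : numberOfTriangles G V′ ≡ weight triangle (classSize arcClass)
  numberOfTriangles≡ = trans
    (numberOfSubsets-cong (λ S → isTriangle? G ⟨ V′ , S ⟩) (transversal? arcClass triangle) (triangle⁻ , triangle⁺))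
    (numberOfTransversals arcClass triangle)

-- Splitting a degree over the classes of arcs.

-- With indicators, disjointness and covering become a single pointwise equation, which
-- `edgeAt-indicator` settles by a finite check.
∣tabulate∣-+ : ∀ {m} (f g h k : Fin m → Bool) →
  (∀ e → indicator (f e) ≡ indicator (g e) + indicator (h e) + indicator (k e)) →
  ∣ Vec.tabulate f ∣ ≡ ∣ Vec.tabulate g ∣ + ∣ Vec.tabulate h ∣ + ∣ Vec.tabulate k ∣
∣tabulate∣-+ {zero}  f g h k eq = refl
∣tabulate∣-+ {suc m} f g h k eq
  rewrite ∣b∷p∣ (f zero) (Vec.tabulate (f ∘ suc)) | ∣b∷p∣ (g zero) (Vec.tabulate (g ∘ suc))
        | ∣b∷p∣ (h zero) (Vec.tabulate (h ∘ suc)) | ∣b∷p∣ (k zero) (Vec.tabulate (k ∘ suc))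
        | eq zero | ∣tabulate∣-+ (f ∘ suc) (g ∘ suc) (h ∘ suc) (k ∘ suc) (eq ∘ suc) =
  rearrange (indicator (g zero)) (indicator (h zero)) (indicator (k zero)) _ _ _
  where
  rearrange : ∀ a b c a′ b′ c′ → a + b + c + (a′ + b′ + c′) ≡ a + a′ + (b + b′) + (c + c′)
  rearrange = ℕ-Solver.solve-∀

-- `punchIn c` skips `c`, so `j` runs over the three edges at `c`, with the edge to 0 first when `c`
-- is not 0.
edgeAt : Fin 4 → Fin 3 → Fin 7
edgeAt c j = edge c (punchIn c j)

abstract

  edgeAt-indicator : ∀ c t →
    indicator (does (Fin.any? λ j → edgeAt c j Fin.≟ t)) ≡
      indicator (does (t Fin.≟ edgeAt c zero)) + indicator (does (t Fin.≟ edgeAt c (suc zero)))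
        + indicator (does (t Fin.≟ edgeAt c (suc (suc zero))))
  edgeAt-indicator = from-yes (Fin.all? λ c → Fin.all? λ t →
    indicator (does (Fin.any? λ j → edgeAt c j Fin.≟ t)) ℕ.≟
      indicator (does (t Fin.≟ edgeAt c zero)) + indicator (does (t Fin.≟ edgeAt c (suc zero)))
        + indicator (does (t Fin.≟ edgeAt c (suc (suc zero)))))

-- The enumeration of a subset.

elements-∈ : ∀ {n} (S : Subset n) i → lookup (elements S) i ∈ S
elements-∈ (inside  ∷ S) zero    = here
elements-∈ (inside  ∷ S) (suc i) =
  subst (_∈ inside ∷ S) (sym (Vec.lookup-map i suc (elements S))) (there (elements-∈ S i))
elements-∈ (outside ∷ S) i       =
  subst (_∈ outside ∷ S) (sym (Vec.lookup-map i suc (elements S))) (there (elements-∈ S i))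

elements-injective : ∀ {n} (S : Subset n) {i j} → lookup (elements S) i ≡ lookup (elements S) j → i ≡ j
elements-injective (inside ∷ S) {zero}  {zero}  _  = refl
elements-injective (inside ∷ S) {zero}  {suc j} eq =
  contradiction (trans eq (Vec.lookup-map j suc (elements S))) λ ()
elements-injective (inside ∷ S) {suc i} {zero}  eq =
  contradiction (trans (sym eq) (Vec.lookup-map i suc (elements S))) λ ()
elements-injective (inside ∷ S) {suc i} {suc j} eq = cong suc (elements-injective S (Fin.suc-injective
  (trans (sym (Vec.lookup-map i suc (elements S))) (trans eq (Vec.lookup-map j suc (elements S))))))
elements-injective (outside ∷ S) {i} {j} eq = elements-injective S (Fin.suc-injective
  (trans (sym (Vec.lookup-map i suc (elements S))) (trans eq (Vec.lookup-map j suc (elements S)))))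

elements-surjective : ∀ {n} (S : Subset n) {v} → v ∈ S → ∃ λ i → lookup (elements S) i ≡ v
elements-surjective (inside ∷ S) here = zero , refl
elements-surjective (inside ∷ S) (there v∈) = let i , eq = elements-surjective S v∈ in
  suc i , trans (Vec.lookup-map i suc (elements S)) (cong suc eq)
elements-surjective (outside ∷ S) (there v∈) = let i , eq = elements-surjective S v∈ in
  i , trans (Vec.lookup-map i suc (elements S)) (cong suc eq)

-- Three-by-three determinants over the Gaussian integers.

-- With the nine entries as arguments, each can be replaced by congruence and no equality of
-- functions is needed.
det₃ : (a b c d e f g h i : ℤ[i]) → ℤ[i]
det₃ a b c d e f g h i = det λ r → lookup (lookup ((a ∷ b ∷ c ∷ []) ∷ (d ∷ e ∷ f ∷ []) ∷ (g ∷ h ∷ i ∷ []) ∷ []) r)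

module _ where

  open ℤ-Solver.+-*-Solver

  private
    -- Real and imaginary part are kept apart because the solver decides equations over ℤ.
    ℂ = Polynomial 6 × Polynomial 6

    infixl 7 _⊗′_
    infixl 6 _⊕′_

    _⊕′_ _⊗′_ : ℂ → ℂ → ℂ
    (a , b) ⊕′ (c , d) = (a :+ c) , (b :+ d)
    (a , b) ⊗′ (c , d) = (a :* c :- b :* d) , (a :* d :+ b :* c)

    ⊖′_ : ℂ → ℂ
    ⊖′ (a , b) = (:- a) , (:- b)

    real imag : Polynomial 6 → ℂ
    real a = a , con 0ℤ
    imag a = con 0ℤ , a

    -- Mirrors the unfolding of det, so that the denotations agree definitionally.
    det₃′ : (a b c d e f g h i : ℂ) → ℂ
    det₃′ a b c d e f g h i =
      a ⊗′ det₂ e f h i ⊕′ ((⊖′ (b ⊗′ det₂ d f g i)) ⊕′ ((⊖′ ⊖′ (c ⊗′ det₂ d e g h)) ⊕′ real (con 0ℤ)))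
      where
      det₁ : ℂ → ℂ
      det₁ a = a ⊗′ real (con 1ℤ) ⊕′ real (con 0ℤ)
      det₂ : (a b c d : ℂ) → ℂ
      det₂ a b c d = a ⊗′ det₁ d ⊕′ ((⊖′ (b ⊗′ det₁ c)) ⊕′ real (con 0ℤ))

    mirror₂ mirror₄ : (a b c x y z : Polynomial 6) → ℂ
    mirror₂ a b c x y z = det₃′ (real a) (real x) (real y)
                                (real x) (real b) (real z)
                                (real y) (real z) (real c)
    mirror₄ a b c s t u = det₃′ (real a) (imag (:- s)) (imag (:- t))
                                (imag s) (real b) (imag (:- u))
                                (imag t) (imag u) (real c)

  det₃-real : ∀ a b c x y z →
    det₃ (a +i 0ℤ) (x +i 0ℤ) (y +i 0ℤ)
         (x +i 0ℤ) (b +i 0ℤ) (z +i 0ℤ)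
         (y +i 0ℤ) (z +i 0ℤ) (c +i 0ℤ) ≡
    a ℤ.* (b ℤ.* c) ℤ.+ + 2 ℤ.* (x ℤ.* (y ℤ.* z)) ℤ.- (a ℤ.* (z ℤ.* z) ℤ.+ b ℤ.* (y ℤ.* y) ℤ.+ c ℤ.* (x ℤ.* x)) +i 0ℤ
  det₃-real a b c x y z = cong₂ _+i_
    (solve 6 (λ a b c x y z → proj₁ (mirror₂ a b c x y z) :=
       a :* (b :* c) :+ con (+ 2) :* (x :* (y :* z)) :- (a :* (z :* z) :+ b :* (y :* y) :+ c :* (x :* x))) refl a b c x y z)
    (solve 6 (λ a b c x y z → proj₂ (mirror₂ a b c x y z) := con 0ℤ) refl a b c x y z)

  det₃-imag : ∀ a b c s t u →
    det₃ (a +i 0ℤ) (0ℤ +i (ℤ.- s)) (0ℤ +i (ℤ.- t))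
         (0ℤ +i s) (b +i 0ℤ) (0ℤ +i (ℤ.- u))
         (0ℤ +i t) (0ℤ +i u) (c +i 0ℤ) ≡
    a ℤ.* (b ℤ.* c) ℤ.- (a ℤ.* (u ℤ.* u) ℤ.+ b ℤ.* (t ℤ.* t) ℤ.+ c ℤ.* (s ℤ.* s)) +i 0ℤ
  det₃-imag a b c s t u = cong₂ _+i_
    (solve 6 (λ a b c s t u → proj₁ (mirror₄ a b c s t u) :=
       a :* (b :* c) :- (a :* (u :* u) :+ b :* (t :* t) :+ c :* (s :* s))) refl a b c s t u)
    (solve 6 (λ a b c s t u → proj₂ (mirror₄ a b c s t u) := con 0ℤ) refl a b c s t u)

-- The summands follow the order of spanningTrees, so that the sum over that list unfolds to
-- them; the squares on the right disappear once x, y, z are known to be 0 or 1.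
spanning-tree-identity : ∀ p q r x y z →
  (p + x + y) * ((q + x + z) * (r + y + z)) ≡
  (p * (q * (r * 1)) + (p * (q * (y * 1)) + (p * (q * (z * 1)) + (p * (r * (x * 1))
    + (p * (x * (y * 1)) + (p * (x * (z * 1)) + (p * (r * (z * 1)) + (p * (y * (z * 1))
    + (q * (r * (x * 1)) + (q * (x * (y * 1)) + (q * (x * (z * 1)) + (r * (x * (z * 1))
    + (q * (r * (y * 1)) + (q * (y * (z * 1)) + (r * (x * (y * 1)) + (r * (y * (z * 1)) + 0))))))))))))))))
    + ((p + x + y) * (z * z) + (q + x + z) * (y * y) + (r + y + z) * (x * x) + 2 * (x * (y * z)))
spanning-tree-identity = ℕ-Solver.solve-∀

-- The two minors in terms of class sizes.

module Determinants {n m : ℕ} (G : OrientedGraph n m) (V′ : Subset n) (ι : Fin 3 → Fin n)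
  (ι-injective : ∀ {i j} → ι i ≡ ι j → i ≡ j) (ι-∈ : ∀ i → ι i ∈ V′)
  (ι-surjective : ∀ {v} → v ∈ V′ → ∃ λ i → ι i ≡ v) where

  open OrientedGraph G
  open Contraction G V′ ι ι-injective ι-∈ ι-surjective

  private
    size : Fin 7 → ℕ
    size = classSize arcClass

    variable
      u v : Fin n

  -- The other end of an arc at `ι i` falls into exactly one of the three other vertices of K₄, the
  -- outside counting as 0.
  degree : ∀ i → let c = suc i in
    ∣ incidentArcs G (ι i) ∣ ≡ size (edgeAt c zero) + size (edgeAt c (suc zero)) + size (edgeAt c (suc (suc zero)))
  degree i = ∣tabulate∣-+ _ _ _ _ λ e → trans
    (cong indicator (does-⇔ (mk⇔ to from) (incident? G (ι i) e) (Fin.any? λ j → edgeAt (suc i) j Fin.≟ arcClass e)))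
    (edgeAt-indicator (suc i) (arcClass e))
    where
    to : ∀ {e} → Incident G (ι i) e → ∃ λ j → edgeAt (suc i) j ≡ arcClass e
    to inc = let v , je = incident-joins G inc ; i≢v = joins-ι≢ je in
      punchOut i≢v , trans (cong (edge (suc i)) (Fin.punchIn-punchOut i≢v)) (sym (arcClass-ι je))

    from : ∀ {e} → (∃ λ j → edgeAt (suc i) j ≡ arcClass e) → Incident G (ι i) e
    from (j , eq) = let w , je , _ = arcClass-ι⁻ (Fin.punchInᵢ≢i (suc i) j ∘ sym) (sym eq) in joins-incident G je

  laplacian-diagonal : ∀ ω u → laplacian G ω u u ≡ fromℕ ∣ incidentArcs G u ∣
  laplacian-diagonal ω u rewrite dec-true (u Fin.≟ u) refl = refl

  laplacian-arc : ∀ ω → u ≢ v → Arc G u v → laplacian G ω u v ≡ ⊖ ω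
  laplacian-arc {u} {v} ω u≢v uv rewrite dec-false (u Fin.≟ v) u≢v | dec-true (arc? G u v) uv = refl

  laplacian-opposite : ∀ ω → u ≢ v → ¬ Arc G u v → Arc G v u → laplacian G ω u v ≡ ⊖ conj ω
  laplacian-opposite {u} {v} ω u≢v ¬uv vu
    rewrite dec-false (u Fin.≟ v) u≢v | dec-false (arc? G u v) ¬uv | dec-true (arc? G v u) vu = refl

  laplacian-none : ∀ ω → u ≢ v → ¬ Arc G u v → ¬ Arc G v u → laplacian G ω u v ≡ fromℕ 0
  laplacian-none {u} {v} ω u≢v ¬uv ¬vu
    rewrite dec-false (u Fin.≟ v) u≢v | dec-false (arc? G u v) ¬uv | dec-false (arc? G v u) ¬vu = refl

  -- s is 1, -1 or 0 according to the direction of the arc between ι i and ι j.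
  record Link (i j : Fin 3) : Set where
    size-ij : ℕ
    size-ij = size (edge (suc i) (suc j))
    x : ℤ
    x = + size-ij
    field
      s          : ℤ
      idempotent : size-ij * size-ij ≡ size-ij
      s² : s ℤ.* s ≡ x
      laplacian₂  : laplacian G ω₂ (ι i) (ι j) ≡ x +i 0ℤ
      laplacian₂ᵒ : laplacian G ω₂ (ι j) (ι i) ≡ x +i 0ℤ
      laplacian₄  : laplacian G ω₄ (ι i) (ι j) ≡ 0ℤ +i (ℤ.- s)
      laplacian₄ᵒ : laplacian G ω₄ (ι j) (ι i) ≡ 0ℤ +i s
    x² : x ℤ.* x ≡ x
    x² = trans (sym (ℤ.pos-* size-ij size-ij)) (cong +_ idempotent)

  link : ∀ i j → i ≢ j → Link i j
  link i j i≢j = by-arcs (arc? G (ι i) (ι j)) (arc? G (ι j) (ι i))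
    where
    side = edge (suc i) (suc j)

    i≢j′ : ι i ≢ ι j
    i≢j′ = i≢j ∘ ι-injective

    j≢i′ : ι j ≢ ι i
    j≢i′ = i≢j′ ∘ sym

    size-one : ∀ {e} → Joins G e (ι i) (ι j) → size side ≡ 1
    size-one {e} je = ∣p∣≡1⁺ (∈-subsetOf⁺ (λ e → arcClass e Fin.≟ side) (arcClass-ιι je))
      λ f∈ → side-unique i≢j (∈-subsetOf⁻ (λ e → arcClass e Fin.≟ side) f∈) (arcClass-ιι je)

    size-zero : ¬ Arc G (ι i) (ι j) → ¬ Arc G (ι j) (ι i) → size side ≡ 0
    size-zero ¬ij ¬ji = ∣p∣≡0⁺ λ e∈ → none (arcClass-side⁻ i≢j (∈-subsetOf⁻ (λ e → arcClass e Fin.≟ side) e∈))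
      where
      none : ∀ {e} → ¬ Joins G e (ι i) (ι j)
      none {e} (inj₁ ends) = ¬ij (e , ends)
      none {e} (inj₂ ends) = ¬ji (e , ends)

    not-both : Arc G u v → ¬ Arc G v u
    not-both (e , s , t) (f , s′ , t′) = noOpposite e f (trans s (sym t′)) (trans t (sym s′))

    -- The class size does not compute. With a variable `c` in its place, the arithmetic is checked
    -- by `refl` at the numeral 0 or 1.
    build : ∀ {c} s → size side ≡ c → c * c ≡ c → s ℤ.* s ≡ + c →
            laplacian G ω₂ (ι i) (ι j) ≡ + c +i 0ℤ → laplacian G ω₂ (ι j) (ι i) ≡ + c +i 0ℤ →
            laplacian G ω₄ (ι i) (ι j) ≡ 0ℤ +i (ℤ.- s) → laplacian G ω₄ (ι j) (ι i) ≡ 0ℤ +i s → Link i j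
    build s refl idem s² l₂ l₂ᵒ l₄ l₄ᵒ = record
      { s = s ; idempotent = idem ; s² = s² ; laplacian₂ = l₂ ; laplacian₂ᵒ = l₂ᵒ ; laplacian₄ = l₄ ; laplacian₄ᵒ = l₄ᵒ }

    by-arcs : Dec (Arc G (ι i) (ι j)) → Dec (Arc G (ι j) (ι i)) → Link i j
    by-arcs (yes ij@(_ , ends)) _ = build 1ℤ (size-one (inj₁ ends)) refl refl
      (laplacian-arc ω₂ i≢j′ ij) (laplacian-opposite ω₂ j≢i′ (not-both ij) ij)
      (laplacian-arc ω₄ i≢j′ ij) (laplacian-opposite ω₄ j≢i′ (not-both ij) ij)
    by-arcs (no ¬ij) (yes ji@(_ , ends)) = build -1ℤ (size-one (inj₂ ends)) refl refl
      (laplacian-opposite ω₂ i≢j′ ¬ij ji) (laplacian-arc ω₂ j≢i′ ji)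
      (laplacian-opposite ω₄ i≢j′ ¬ij ji) (laplacian-arc ω₄ j≢i′ ji)
    by-arcs (no ¬ij) (no ¬ji) = build 0ℤ (size-zero ¬ij ¬ji) refl refl
      (laplacian-none ω₂ i≢j′ ¬ij ¬ji) (laplacian-none ω₂ j≢i′ ¬ji ¬ij)
      (laplacian-none ω₄ i≢j′ ¬ij ¬ji) (laplacian-none ω₄ j≢i′ ¬ji ¬ij)

  private
    module L₀₁ = Link (link zero (suc zero) λ ())
    module L₀₂ = Link (link zero (suc (suc zero)) λ ())
    module L₁₂ = Link (link (suc zero) (suc (suc zero)) λ ())

    A B C X Y Z : ℕ
    A = ∣ incidentArcs G (ι zero) ∣
    B = ∣ incidentArcs G (ι (suc zero)) ∣
    C = ∣ incidentArcs G (ι (suc (suc zero))) ∣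
    X = L₀₁.size-ij
    Y = L₀₂.size-ij
    Z = L₁₂.size-ij

    -- The diagonal product, the two cyclic terms for `ω₂`, and the transposition terms, whose
    -- squares are already reduced.
    P Q R : ℤ
    P = + A ℤ.* (+ B ℤ.* + C)
    Q = + 2 ℤ.* (+ X ℤ.* (+ Y ℤ.* + Z))
    R = + A ℤ.* + Z ℤ.+ + B ℤ.* + Y ℤ.+ + C ℤ.* + X

    det₃-cong : ∀ {a a′ b b′ c c′ d d′ e e′ f f′ g g′ h h′ i i′} →
      a ≡ a′ → b ≡ b′ → c ≡ c′ → d ≡ d′ → e ≡ e′ → f ≡ f′ → g ≡ g′ → h ≡ h′ → i ≡ i′ →
      det₃ a b c d e f g h i ≡ det₃ a′ b′ c′ d′ e′ f′ g′ h′ i′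
    det₃-cong refl refl refl refl refl refl refl refl refl = refl

    R-cong : ∀ {x′ y′ z′} → x′ ≡ + X → y′ ≡ + Y → z′ ≡ + Z → + A ℤ.* z′ ℤ.+ + B ℤ.* y′ ℤ.+ + C ℤ.* x′ ≡ R
    R-cong refl refl refl = refl

  minor : ℤ[i] → ℤ[i]
  minor ω = det λ r s → laplacian G ω (ι r) (ι s)

  minor-ω₂ : minor ω₂ ≡ P ℤ.+ Q ℤ.- R +i 0ℤ
  minor-ω₂ = trans
    (det₃-cong (laplacian-diagonal ω₂ _) L₀₁.laplacian₂ L₀₂.laplacian₂
               L₀₁.laplacian₂ᵒ (laplacian-diagonal ω₂ _) L₁₂.laplacian₂
               L₀₂.laplacian₂ᵒ L₁₂.laplacian₂ᵒ (laplacian-diagonal ω₂ _))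
    (trans (det₃-real (+ A) (+ B) (+ C) (+ X) (+ Y) (+ Z)) (cong (λ R → P ℤ.+ Q ℤ.- R +i 0ℤ) (R-cong L₀₁.x² L₀₂.x² L₁₂.x²)))

  minor-ω₄ : minor ω₄ ≡ P ℤ.- R +i 0ℤ
  minor-ω₄ = trans
    (det₃-cong (laplacian-diagonal ω₄ _) L₀₁.laplacian₄ L₀₂.laplacian₄
               L₀₁.laplacian₄ᵒ (laplacian-diagonal ω₄ _) L₁₂.laplacian₄
               L₀₂.laplacian₄ᵒ L₁₂.laplacian₄ᵒ (laplacian-diagonal ω₄ _))
    (trans (det₃-imag (+ A) (+ B) (+ C) L₀₁.s L₀₂.s L₁₂.s) (cong (λ R → P ℤ.- R +i 0ℤ) (R-cong L₀₁.s² L₀₂.s² L₁₂.s²)))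

  private
    difference : ∀ P Q R → (P ℤ.+ Q ℤ.- R +i 0ℤ) ⊝ (P ℤ.- R +i 0ℤ) ≡ Q +i 0ℤ
    difference P Q R = cong (_+i 0ℤ)
      (solve 3 (λ P Q R → (P :+ Q :- R) :+ (:- (P :- R)) := Q) refl P Q R)
      where open ℤ-Solver.+-*-Solver

    doubleDifference : ∀ P Q R → (fromℕ 2 ⊗ (P ℤ.- R +i 0ℤ)) ⊝ (P ℤ.+ Q ℤ.- R +i 0ℤ) ≡ P ℤ.- (R ℤ.+ Q) +i 0ℤ
    doubleDifference P Q R = cong₂ _+i_
      (solve 3 (λ P Q R → (con (+ 2) :* (P :- R) :- con 0ℤ :* con 0ℤ) :+ (:- (P :+ Q :- R)) := P :- (R :+ Q)) refl P Q R)
      (solve 3 (λ P Q R → (con (+ 2) :* con 0ℤ :+ con 0ℤ :* (P :- R)) :+ (:- con 0ℤ) := con 0ℤ) refl P Q R)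
      where open ℤ-Solver.+-*-Solver

    pos-product : ∀ k l n → + (k * (l * n)) ≡ + k ℤ.* (+ l ℤ.* + n)
    pos-product k l n = trans (ℤ.pos-* k (l * n)) (cong (+ k ℤ.*_) (ℤ.pos-* l n))

    Q≡ : + (2 * (X * (Y * Z))) ≡ Q
    Q≡ = trans (ℤ.pos-* 2 (X * (Y * Z))) (cong (+ 2 ℤ.*_) (pos-product X Y Z))

    R≡ : + (A * Z + B * Y + C * X) ≡ R
    R≡ = cong₂ ℤ._+_ (cong₂ ℤ._+_ (ℤ.pos-* A Z) (ℤ.pos-* B Y)) (ℤ.pos-* C X)

    -- Kirchhoff's theorem for K₄ with the class sizes as edge weights, with the negative terms of
    -- the reduced Laplacian determinant moved to the right so that it can be stated in ℕ.
    forest-sum : A * (B * C) ≡ numberOfRootlessForests G V′ 3 + (A * Z + B * Y + C * X + 2 * (X * (Y * Z)))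
    forest-sum = begin
      A * (B * C)
        ≡⟨ cong₂ _*_ (degree zero) (cong₂ _*_ (degree (suc zero)) (degree (suc (suc zero)))) ⟩
      A′ * (B′ * C′)
        ≡⟨ spanning-tree-identity (size (# 1)) (size (# 2)) (size (# 3)) X Y Z ⟩
      F + (A′ * (Z * Z) + B′ * (Y * Y) + C′ * (X * X) + 2 * (X * (Y * Z)))
        -- Class sizes inside `V′` are 0 or 1, so their squares collapse.
        ≡⟨ cong (λ k → F + (k + 2 * (X * (Y * Z)))) (cong₂ _+_ (cong₂ _+_
             (cong₂ _*_ (sym (degree zero)) L₁₂.idempotent)
             (cong₂ _*_ (sym (degree (suc zero))) L₀₂.idempotent))
             (cong₂ _*_ (sym (degree (suc (suc zero)))) L₀₁.idempotent)) ⟩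
      F + (A * Z + B * Y + C * X + 2 * (X * (Y * Z)))
        ≡⟨ cong (_+ (A * Z + B * Y + C * X + 2 * (X * (Y * Z)))) (sym numberOfForests) ⟩
      numberOfRootlessForests G V′ 3 + (A * Z + B * Y + C * X + 2 * (X * (Y * Z))) ∎
      where
      open ≡-Reasoning
      A′ = size (# 1) + X + Y
      B′ = size (# 2) + X + Z
      C′ = size (# 3) + Y + Z
      F = ListAction.sum (List.map (λ K → weight K size) spanningTrees)

  triangles : minor ω₂ ⊝ minor ω₄ ≡ fromℕ (2 * numberOfTriangles G V′)
  triangles = trans (cong₂ _⊝_ minor-ω₂ minor-ω₄) (trans (difference P Q R) (cong (_+i 0ℤ)
    (trans (sym Q≡) (cong (λ k → + (2 * k)) (sym (trans numberOfTriangles≡ (cong (λ k → X * (Y * k)) (ℕ.*-identityʳ Z))))))))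

  forests : (fromℕ 2 ⊗ minor ω₄) ⊝ minor ω₂ ≡ fromℕ (numberOfRootlessForests G V′ 3)
  forests = trans (cong₂ (λ D D′ → (fromℕ 2 ⊗ D) ⊝ D′) minor-ω₄ minor-ω₂)
    (trans (doubleDifference P Q R) (cong (_+i 0ℤ) (begin
      -- `forest-sum` turns `P` into `F + N`, and `R + Q` is `N`.
      P ℤ.- (R ℤ.+ Q)        ≡⟨ cong₂ ℤ._-_ (sym (trans (cong +_ (sym forest-sum)) (pos-product A B C))) (cong₂ ℤ._+_ (sym R≡) (sym Q≡)) ⟩
      + (F + N) ℤ.- + N      ≡⟨ cong (ℤ._- + N) (ℤ.pos-+ F N) ⟩
      + F ℤ.+ + N ℤ.- + N    ≡⟨ ℤ.+-assoc (+ F) (+ N) (ℤ.- + N) ⟩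
      + F ℤ.+ (+ N ℤ.- + N)  ≡⟨ cong (λ k → + F ℤ.+ k) (ℤ.+-inverseʳ (+ N)) ⟩
      + F ℤ.+ 0ℤ             ≡⟨ ℤ.+-identityʳ (+ F) ⟩
      + F                    ∎)))
    where
    open ≡-Reasoning
    F = numberOfRootlessForests G V′ 3
    N = A * Z + B * Y + C * X + 2 * (X * (Y * Z))

-- The size of `V′` is not a variable and cannot be unified with 3. For a vector of arbitrary length
-- `k` the equation `k ≡ 3` can be matched, after which the determinant unfolds.
principal-minor : ∀ {n m k} (G : OrientedGraph n m) (V′ : Subset n) (xs : Vec (Fin n) k) → k ≡ 3 →
  (∀ {i j} → lookup xs i ≡ lookup xs j → i ≡ j) → (∀ i → lookup xs i ∈ V′) →
  (∀ {v} → v ∈ V′ → ∃ λ i → lookup xs i ≡ v) →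
  let D = λ ω → det (λ r c → laplacian G ω (lookup xs r) (lookup xs c)) in
  (D ω₂ ⊝ D ω₄ ≡ fromℕ (2 * numberOfTriangles G V′)) ×
  ((fromℕ 2 ⊗ D ω₄) ⊝ D ω₂ ≡ fromℕ (numberOfRootlessForests G V′ 3))
principal-minor G V′ xs refl inj ∈V′ surj = triangles , forests
  where open Determinants G V′ (lookup xs) inj ∈V′ surj

mainTheorem17 : ∀ {n m : ℕ} (G : OrientedGraph n m) (V′ : Subset n) → ∣ V′ ∣ ≡ 3 →
    let T = numberOfTriangles G V′
        F = numberOfRootlessForests G V′ 3
        D₂ = det (principal (laplacian G ω₂) V′)
        D₄ = det (principal (laplacian G ω₄) V′)
    in (D₂ ⊝ D₄ ≡ fromℕ (2 * T)) × ((fromℕ 2 ⊗ D₄) ⊝ D₂ ≡ fromℕ F)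
mainTheorem17 G V′ three =
  principal-minor G V′ (elements V′) three (elements-injective V′) (elements-∈ V′) (elements-surjective V′)
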